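{- Let $\mathfrak p$ be any dyadic prime of any number field $F$. There is no classic $2$-universal quaternary (rank $4$) lattice over the dyadic local field $F_{\mathfrak p}$ (i.e. no classic $2$-universal $\mathcal{O}_{\mathfrak p}$-lattice of rank $4$).
   Context: $F_{\mathfrak p}$ is the completion of $F$ at $\mathfrak p$ and $\mathcal{O}_{\mathfrak p}$ its valuation ring; dyadic means $\mathfrak p\mid 2$. Quadratic spaces are finite-dimensional over $F_{\mathfrak p}$ with a non-degenerate symmetric bilinear form $B$, $Q(x)=B(x,x)$. An $\mathcal{O}_{\mathfrak p}$-lattice is a finitely generated $\mathcal{O}_{\mathfrak p}$-submodule of a quadratic space, regarded as spanning a non-degenerate space; it is classic integral if $B(L,L)\subseteq\mathcal{O}_{\mathfrak p}$. $L$ is represented by $M$ if there is a linear map $\sigma$ from the span of $L$ to the span of $M$, preserving the quadratic forms, with $\sigma(L)\subseteq M$. A classic integral $\mathcal{O}_{\mathfrak p}$-lattice is classic $2$-universal if it represents all classic integral $\mathcal{O}_{\mathfrak p}$-lattices of rank $2$. -}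

module Defs where

open import Level using (Level; _⊔_; suc)
open import Algebra.Apartness.Bundles using (HeytingField; HeytingCommutativeRing)
open import Algebra.Bundles using (CommutativeRing)
open import Algebra.Module.Bundles using (Module)
open import Algebra.Module.Morphism.Structures using (module ModuleMorphisms)
open import Algebra.Morphism.Structures using (module RingMorphisms)
import Algebra.Properties.CommutativeMonoid.Sum as Sum
import Algebra.Properties.Semiring.Exp as Exp
open import Data.Fin.Base using (toℕ)
open import Data.Integer.Base as ℤ using (ℤ; +_)
open import Data.Nat.Base as ℕ using (ℕ)
open import Data.Product.Base using (Σ-syntax; ∃; ∃-syntax; _×_)
open import Data.Rational.Base as ℚ using (ℚ)
open import Data.Sum.Base using (_⊎_)
open import Data.Vec.Functional using (Vector)
open import Function.Bundles using (_⇔_)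
open import Relation.Binary.Construct.Add.Supremum.NonStrict ℤ._≤_ using () renaming (_≤⁺_ to _≤∞_) public
open import Relation.Binary.PropositionalEquality.Core using (_≡_; _≢_)
open import Relation.Nullary.Construct.Add.Supremum using (_⁺; [_]; ⊤⁺)
open import Relation.Nullary.Negation.Core using (¬_)

------------------------------------------------------------------------
-- Fields

-- The library's constructive fields: x # y means that x - y is
-- invertible, and apartness is tight (not x # y implies x ≈ y), so
-- classically _#_ is the negation of _≈_ and these are exactly fields.

module Field {c ℓ₁ ℓ₂} (K : HeytingField c ℓ₁ ℓ₂) where
  open HeytingField K using (_#_; heytingCommutativeRing) public
  open HeytingCommutativeRing heytingCommutativeRing using (commutativeRing) public
  open CommutativeRing commutativeRing public
  open Sum +-commutativeMonoid using (sum) public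
  open Exp semiring using (_^_) public

IsFieldEmbedding : ∀ {c ℓ₁ ℓ₂ d m₁ m₂} (K : HeytingField c ℓ₁ ℓ₂) (K′ : HeytingField d m₁ m₂) →
  (Field.Carrier K → Field.Carrier K′) → Set (c ⊔ ℓ₁ ⊔ m₁)
IsFieldEmbedding K K′ = RingMorphisms.IsRingHomomorphism (Field.rawRing K) (Field.rawRing K′)

------------------------------------------------------------------------
-- Number fields

-- A finite extension of ℚ, given by a ring homomorphism from ℚ (which
-- forces characteristic 0) and a finite spanning set over ℚ.

record NumberField c ℓ₁ ℓ₂ : Set (suc (c ⊔ ℓ₁ ⊔ ℓ₂)) where
  field
    heytingField : HeytingField c ℓ₁ ℓ₂
  open Field heytingField public
  field
    fromℚ                  : ℚ → Carrier
    fromℚ-isRingHomomorphism :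
      RingMorphisms.IsRingHomomorphism ℚ.+-*-rawRing rawRing fromℚ
    finite                 :
      ∃[ n ] Σ[ e ∈ Vector Carrier n ] ∀ x →
        Σ[ q ∈ Vector ℚ n ] x ≈ sum (λ i → fromℚ (q i) * e i)

  fromℤ : ℤ → Carrier
  fromℤ z = fromℚ (z ℚ./ 1)

  -- The ring of integers 𝒪_F: the roots in F of monic polynomials
  -- Xⁿ + a_{n-1} Xⁿ⁻¹ + ⋯ + a₀ with integer coefficients.
  Integral : Carrier → Set ℓ₁
  Integral x = ∃[ n ] Σ[ a ∈ Vector ℤ n ]
    x ^ n + sum (λ i → fromℤ (a i) * x ^ toℕ i) ≈ 0#

-- A prime ideal 𝔭 of 𝒪_F with 𝔭 ∣ 2, i.e. 2 ∈ 𝔭; in particular 𝔭 ≠ 0.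

record DyadicPrime {c ℓ₁ ℓ₂} (F : NumberField c ℓ₁ ℓ₂) p : Set (c ⊔ ℓ₁ ⊔ suc p) where
  open NumberField F
  field
    _∈𝔭      : Carrier → Set p
    ∈𝔭-resp  : ∀ {x y} → x ≈ y → x ∈𝔭 → y ∈𝔭
    integral : ∀ {x} → x ∈𝔭 → Integral x
    0∈𝔭      : 0# ∈𝔭
    +-closed : ∀ {x y} → x ∈𝔭 → y ∈𝔭 → (x + y) ∈𝔭
    *-closed : ∀ {a x} → Integral a → x ∈𝔭 → (a * x) ∈𝔭
    1∉𝔭      : ¬ (1# ∈𝔭)
    prime    : ∀ {x y} → Integral x → Integral y → (x * y) ∈𝔭 → x ∈𝔭 ⊎ y ∈𝔭
    2∈𝔭      : (1# + 1#) ∈𝔭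

  -- x ∈𝔭^ n : membership in the ideal power 𝔭ⁿ, with 𝔭⁰ = 𝒪_F and
  -- 𝔭ⁿ⁺¹ the set of finite sums Σ aᵢ bᵢ with aᵢ ∈ 𝔭 and bᵢ ∈ 𝔭ⁿ.
  data _∈𝔭^_ (x : Carrier) : ℕ → Set (c ⊔ ℓ₁ ⊔ p) where
    unit    : Integral x → x ∈𝔭^ 0
    product : ∀ {n k} (a b : Vector Carrier k) →
              (∀ i → a i ∈𝔭) → (∀ i → b i ∈𝔭^ n) →
              x ≈ sum (λ i → a i * b i) → x ∈𝔭^ (ℕ.suc n)

------------------------------------------------------------------------
-- Discrete valuations and completions

ℤ∞ : Set
ℤ∞ = ℤ ⁺

infixl 6 _+∞_

_+∞_ : ℤ∞ → ℤ∞ → ℤ∞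
[ m ] +∞ [ n ] = [ m ℤ.+ n ]
[ m ] +∞ ⊤⁺    = ⊤⁺
⊤⁺    +∞ _     = ⊤⁺

module _ {k κ₁ κ₂} (K : HeytingField k κ₁ κ₂) where
  open Field K

  record IsDiscreteValuation (v : Carrier → ℤ∞) : Set (k ⊔ κ₁ ⊔ κ₂) where
    field
      v-cong     : ∀ {x y} → x ≈ y → v x ≡ v y
      -- By tightness this gives v x ≡ ∞ exactly when x ≈ 0.
      v-finite   : ∀ {x} → v x ≢ ⊤⁺ ⇔ x # 0#
      v-*        : ∀ x y → v (x * y) ≡ v x +∞ v y
      v-+        : ∀ {n x y} → n ≤∞ v x → n ≤∞ v y → n ≤∞ v (x + y)
      surjective : ∀ n → ∃[ x ] v x ≡ [ n ]

  Converges : (Carrier → ℤ∞) → (ℕ → Carrier) → Carrier → Set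
  Converges v s x = ∀ (n : ℕ) → ∃[ N ] ∀ i → N ℕ.≤ i → [ + n ] ≤∞ v (s i - x)

  Cauchy : (Carrier → ℤ∞) → (ℕ → Carrier) → Set
  Cauchy v s = ∀ (n : ℕ) → ∃[ N ] ∀ i j → N ℕ.≤ i → N ℕ.≤ j → [ + n ] ≤∞ v (s i - s j)

-- The completion F_𝔭: a field K, complete for a discrete valuation v,
-- containing F as a dense subfield on which v is the 𝔭-adic order. As
-- F = Frac 𝒪_F, it is enough to say that on 𝒪_F, where it means that
-- v(a) ≥ n if and only if a ∈ 𝔭ⁿ.

record Completion {c ℓ₁ ℓ₂ p} (F : NumberField c ℓ₁ ℓ₂) (𝔭 : DyadicPrime F p) k κ₁ κ₂
    : Set (c ⊔ ℓ₁ ⊔ p ⊔ suc (k ⊔ κ₁ ⊔ κ₂)) where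
  private module F = NumberField F
  open DyadicPrime 𝔭 using (_∈𝔭^_)
  field
    heytingField        : HeytingField k κ₁ κ₂
  open Field heytingField public
  field
    v                   : Carrier → ℤ∞
    isDiscreteValuation : IsDiscreteValuation heytingField v
    ι                   : F.Carrier → Carrier
    ι-isFieldEmbedding  : IsFieldEmbedding F.heytingField heytingField ι
    v-𝔭-adic            : ∀ {a} → F.Integral a → ∀ n → [ + n ] ≤∞ v (ι a) ⇔ a ∈𝔭^ n
    dense               : ∀ x (n : ℕ) → ∃[ a ] [ + n ] ≤∞ v (x - ι a)
    complete            : ∀ s → Cauchy heytingField v s → ∃ (Converges heytingField v s)

  -- The valuation ring 𝒪_𝔭.
  _∈𝒪 : Carrier → Set
  x ∈𝒪 = [ + 0 ] ≤∞ v x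

------------------------------------------------------------------------
-- Quadratic spaces and lattices over F_𝔭

module _ {c ℓ₁ ℓ₂ p k κ₁ κ₂} {F : NumberField c ℓ₁ ℓ₂} {𝔭 : DyadicPrime F p}
         (F𝔭 : Completion F 𝔭 k κ₁ κ₂) where
  open Completion F𝔭

  -- Every finite-dimensional space is isomorphic to one at the levels
  -- of F_𝔭 itself, namely to F_𝔭ⁿ, so other levels are not needed.
  record QuadraticSpace : Set (suc (k ⊔ κ₁)) where
    field
      vectorSpace : Module commutativeRing k κ₁
    open Module vectorSpace public
    open Sum +ᴹ-commutativeMonoid renaming (sum to sumᴹ) using () public

    combination : ∀ {n} → Vector Carrier n → Vector Carrierᴹ n → Carrierᴹ
    combination a e = sumᴹ (λ i → a i *ₗ e i)

    field
      dim           : ℕ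
      basis         : Vector Carrierᴹ dim
      spanning      : ∀ x → ∃[ a ] x ≈ᴹ combination a basis
      independent   : ∀ a → combination a basis ≈ᴹ 0ᴹ → ∀ i → a i ≈ 0#

      B             : Carrierᴹ → Carrierᴹ → Carrier
      B-cong        : ∀ {x x′ y y′} → x ≈ᴹ x′ → y ≈ᴹ y′ → B x y ≈ B x′ y′
      B-sym         : ∀ x y → B x y ≈ B y x
      B-+ˡ          : ∀ x y z → B (x +ᴹ y) z ≈ B x z + B y z
      B-*ˡ          : ∀ a x y → B (a *ₗ x) y ≈ a * B x y
      nonDegenerate : ∀ x → (∀ y → B x y ≈ 0#) → x ≈ᴹ 0ᴹ

    Q : Carrierᴹ → Carrier
    Q x = B x x

  -- A finitely generated 𝒪_𝔭-submodule, given by generators, together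
  -- with the non-degenerate space which it spans.
  record Lattice : Set (suc (k ⊔ κ₁)) where
    field
      space      : QuadraticSpace
    open QuadraticSpace space public
    field
      size       : ℕ
      generators : Vector Carrierᴹ size
      spans      : ∀ x → ∃[ a ] x ≈ᴹ combination a generators

    _∈L : Carrierᴹ → Set (k ⊔ κ₁)
    x ∈L = ∃[ a ] (∀ i → a i ∈𝒪) × x ≈ᴹ combination a generators

    rank : ℕ
    rank = dim

  ClassicIntegral : Lattice → Set (k ⊔ κ₁)
  ClassicIntegral L = ∀ {x y} → x ∈L → y ∈L → B x y ∈𝒪
    where open Lattice L

  record _IsRepresentedBy_ (L M : Lattice) : Set (k ⊔ κ₁) where
    private
      module L = Lattice L
      module M = Lattice M
    field
      σ           : L.Carrierᴹ → M.Carrierᴹ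
      σ-linear    : ModuleMorphisms.IsModuleHomomorphism L.rawModule M.rawModule σ
      σ-isometric : ∀ x → M.Q (σ x) ≈ L.Q x
      σ-L⊆M       : ∀ {x} → x L.∈L → σ x M.∈L

  ClassicUniversal : ℕ → Lattice → Set (suc (k ⊔ κ₁))
  ClassicUniversal n M = ClassicIntegral M ×
    (∀ L → Lattice.rank L ≡ n → ClassicIntegral L → L IsRepresentedBy M)

{-# OPTIONS --safe #-}
-- Let 𝔪 be the maximal ideal of 𝒪_𝔭. The residue field has finite degree over 𝔽₂ and x ↦ x² + x has the
-- kernel {0,1} there, so it is not onto: some ρ ∈ 𝒪_𝔭 makes N(x,y) = x² + xy + ρy² anisotropic modulo 𝔪.
--
-- Suppose M is classic 2-universal of rank 4. It represents the hyperbolic plane ⟨e,f⟩, whose orthogonal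
-- complement W is binary; projecting M to W changes norms by elements of 2𝒪_𝔭. Representing ⟨1,π⟩ gives
-- x ∈ M ∩ W of unit norm. There is also y ∈ M ∩ W whose norm is a uniformizer: if 2 ∈ 𝔪², project the
-- vector of norm π; if 2 is itself a uniformizer, M represents 2N and a primitive vector of it orthogonal
-- to e keeps its norm under the projection. Then W has the Gram matrix [u c; c p] with u a unit, p a
-- uniformizer and c integral, and for such a form q there is a unit l for which q(s,t) = l q(z,w) has only
-- the zero solution. But M represents the lattice l q too, and its intersection with e^⊥ projects
-- isometrically to W, which gives a nonzero solution.
--
-- Constructively ρ is obtained only up to double negation, which is enough to refute the universality of M.
module Submission where

open import Defs
open import Level using (_⊔_)
open import Algebra.Apartness.Bundles using (HeytingField)
import Algebra.Apartness.Properties.HeytingCommutativeRing as ApartnessProperties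
open import Algebra.Bundles using (CommutativeRing; module AbelianGroup)
open import Algebra.Module.Bundles using (Module)
import Algebra.Module.Construct.DirectProduct as DirectProduct
import Algebra.Module.Construct.TensorUnit as TensorUnit
open import Algebra.Module.Morphism.Structures using (module ModuleMorphisms)
open import Algebra.Morphism.Structures using (module RingMorphisms)
import Algebra.Properties.AbelianGroup as AbelianGroupProperties
import Algebra.Properties.CommutativeMonoid.Sum as CommutativeMonoidSum
import Algebra.Properties.Group as GroupProperties
import Algebra.Properties.Ring as RingProperties
import Algebra.Properties.Semiring.Mult.TCOptimised as Mult
import Algebra.Properties.Semiring.Sum as SemiringSum
import Algebra.Solver.Ring as RingSolver
open import Algebra.Solver.Ring.AlmostCommutativeRing
  using (fromCommutativeRing; _-Raw-AlmostCommutative⟶_)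
open import Data.Empty using (⊥)
open import Data.Fin.Base using (Fin; zero; suc; punchIn; toℕ)
open import Data.Fin.Patterns using (0F; 1F; 2F; 3F; 4F)
import Data.Fin.Properties as Fin
open import Data.Integer.Base as ℤ using (ℤ; +_; -[1+_])
import Data.Integer.Properties as ℤ
open import Data.Integer.Tactic.RingSolver using (solve-∀)
open import Data.Maybe.Base using (Maybe; just; nothing)
open import Data.Nat.Base as ℕ using (ℕ; zero; suc; z≤n; s≤s)
open import Data.Nat.Coprimality as Coprimality using (Coprime)
open import Data.Nat.Divisibility using (_∣_; _∣0; ∣-refl; ∣m∣n⇒∣m+n)
import Data.Nat.Properties as ℕ
open import Data.Product.Base using (Σ-syntax; ∃-syntax; _×_; _,_; proj₁; proj₂)
open import Data.Rational.Base as ℚ using (ℚ; mkℚ; 0ℚ; 1ℚ; toℚᵘ)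
import Data.Rational.Properties as ℚ
open import Data.Rational.Unnormalised.Base as ℚᵘ using (mkℚᵘ; *≡*)
import Data.Rational.Unnormalised.Properties as ℚᵘ
open import Data.Sum.Base using (_⊎_; inj₁; inj₂)
open import Data.Vec.Functional using (Vector; insertAt; tail; _∷_; [])
open import Data.Vec.Functional.Properties using (insertAt-lookup; insertAt-punchIn)
open import Function.Base using (_∘_)
open import Function.Bundles using (module Equivalence)
open import Relation.Binary.Construct.Add.Supremum.NonStrict ℤ._≤_
  using ([_]; _≤⊤⁺; ≤⁺-trans; ≤⁺-total; ≤⁺-dec; ≤⁺-reflexive-≡)
open import Relation.Binary.PropositionalEquality as ≡ using (_≡_; _≢_)
import Relation.Binary.Reasoning.Setoid as SetoidReasoning
open import Relation.Nullary.Construct.Add.Supremum using (⊤⁺; []-injective) renaming ([_] to fin)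
open import Relation.Nullary.Decidable using (Dec; yes; no; ¬?; decidable-stable)
open import Relation.Nullary.Negation.Core using (¬_; contradiction)

-- Polynomial identities with integer coefficients in a commutative ring

module IntegerRingSolver {c ℓ} (R : CommutativeRing c ℓ) where
  open CommutativeRing R
  open RingProperties ring
  open AbelianGroupProperties +-abelianGroup using (⁻¹-∙-comm)
  open Mult semiring using (1+×; ×-homo-+; ×1-homo-*) renaming (_×_ to _·_)
  open SetoidReasoning setoid

  -- The canonical map from ℤ. With the multiple `_·_` chosen here, `con (+ 1)` and `con (+ 2)`
  -- evaluate to `1#` and `1# + 1#` by computation.
  ⟦_⟧ℤ : ℤ → Carrier
  ⟦ + n ⟧ℤ      = n · 1#
  ⟦ -[1+ n ] ⟧ℤ = - (suc n · 1#)

  ⊖-homo : ∀ m n → ⟦ m ℤ.⊖ n ⟧ℤ ≈ m · 1# - n · 1#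
  ⊖-homo m zero = begin
    m · 1#       ≈⟨ +-identityʳ _ ⟨
    m · 1# + 0#  ≈⟨ +-congˡ -0#≈0# ⟨
    m · 1# - 0#  ∎
  ⊖-homo zero (suc n) = begin
    - (suc n · 1#)   ≈⟨ +-identityˡ _ ⟨
    0# - suc n · 1#  ∎
  ⊖-homo (suc m) (suc n) = begin
    ⟦ suc m ℤ.⊖ suc n ⟧ℤ                ≡⟨ ≡.cong ⟦_⟧ℤ (ℤ.[1+m]⊖[1+n]≡m⊖n m n) ⟩
    ⟦ m ℤ.⊖ n ⟧ℤ                        ≈⟨ ⊖-homo m n ⟩
    m · 1# - n · 1#                     ≈⟨ +-congʳ (+-identityˡ _) ⟨
    -- Inserting 1 - 1 supplies the summand that each of the two successors needs.
    0# + m · 1# - n · 1#                ≈⟨ +-congʳ (+-congʳ (-‿inverseʳ 1#)) ⟨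
    1# - 1# + m · 1# - n · 1#           ≈⟨ +-congʳ (+-assoc _ _ _) ⟩
    1# + (- 1# + m · 1#) - n · 1#       ≈⟨ +-congʳ (+-congˡ (+-comm _ _)) ⟩
    1# + (m · 1# - 1#) - n · 1#         ≈⟨ +-congʳ (+-assoc _ _ _) ⟨
    1# + m · 1# - 1# - n · 1#           ≈⟨ +-assoc _ _ _ ⟩
    1# + m · 1# + (- 1# - n · 1#)       ≈⟨ +-cong (1+× m 1#) (trans (-‿cong (1+× n 1#)) (sym (⁻¹-∙-comm 1# _))) ⟨
    suc m · 1# - suc n · 1#             ∎

  +-homoℤ : ∀ i j → ⟦ i ℤ.+ j ⟧ℤ ≈ ⟦ i ⟧ℤ + ⟦ j ⟧ℤ
  +-homoℤ (+ m)    (+ n)    = ×-homo-+ 1# m n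
  +-homoℤ (+ m)    -[1+ n ] = ⊖-homo m (suc n)
  +-homoℤ -[1+ m ] (+ n)    = trans (⊖-homo n (suc m)) (+-comm _ _)
  +-homoℤ -[1+ m ] -[1+ n ] = begin
    - (suc (suc (m ℕ.+ n)) · 1#)    ≡⟨ ≡.cong (λ k → - (suc k · 1#)) (ℕ.+-suc m n) ⟨
    - ((suc m ℕ.+ suc n) · 1#)      ≈⟨ -‿cong (×-homo-+ 1# (suc m) (suc n)) ⟩
    - (suc m · 1# + suc n · 1#)     ≈⟨ ⁻¹-∙-comm _ _ ⟨
    - (suc m · 1#) - suc n · 1#     ∎

  -‿homoℤ : ∀ i → ⟦ ℤ.- i ⟧ℤ ≈ - ⟦ i ⟧ℤ
  -‿homoℤ (+ zero)  = sym -0#≈0#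
  -‿homoℤ (+ suc n) = refl
  -‿homoℤ -[1+ n ]  = sym (-‿involutive _)

  *-homo⁺ : ∀ m j → ⟦ + m ℤ.* j ⟧ℤ ≈ ⟦ + m ⟧ℤ * ⟦ j ⟧ℤ
  *-homo⁺ m (+ n) = begin
    ⟦ + m ℤ.* + n ⟧ℤ     ≡⟨ ≡.cong ⟦_⟧ℤ (ℤ.pos-* m n) ⟨
    (m ℕ.* n) · 1#       ≈⟨ ×1-homo-* m n ⟩
    (m · 1#) * (n · 1#)  ∎
  *-homo⁺ m -[1+ n ] = begin
    ⟦ + m ℤ.* -[1+ n ] ⟧ℤ        ≡⟨ ≡.cong ⟦_⟧ℤ (ℤ.neg-distribʳ-* (+ m) (+ suc n)) ⟨
    ⟦ ℤ.- (+ m ℤ.* + suc n) ⟧ℤ   ≈⟨ -‿homoℤ (+ m ℤ.* + suc n) ⟩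
    - ⟦ + m ℤ.* + suc n ⟧ℤ       ≈⟨ -‿cong (*-homo⁺ m (+ suc n)) ⟩
    - ((m · 1#) * (suc n · 1#))  ≈⟨ -‿distribʳ-* _ _ ⟩
    (m · 1#) * - (suc n · 1#)    ∎

  *-homoℤ : ∀ i j → ⟦ i ℤ.* j ⟧ℤ ≈ ⟦ i ⟧ℤ * ⟦ j ⟧ℤ
  *-homoℤ (+ m)    j = *-homo⁺ m j
  *-homoℤ -[1+ m ] j = begin
    ⟦ -[1+ m ] ℤ.* j ⟧ℤ        ≡⟨ ≡.cong ⟦_⟧ℤ (ℤ.neg-distribˡ-* (+ suc m) j) ⟨
    ⟦ ℤ.- (+ suc m ℤ.* j) ⟧ℤ   ≈⟨ -‿homoℤ (+ suc m ℤ.* j) ⟩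
    - ⟦ + suc m ℤ.* j ⟧ℤ       ≈⟨ -‿cong (*-homo⁺ (suc m) j) ⟩
    - ((suc m · 1#) * ⟦ j ⟧ℤ)  ≈⟨ -‿distribˡ-* _ _ ⟩
    - (suc m · 1#) * ⟦ j ⟧ℤ    ∎

  morphism : ℤ.+-*-rawRing -Raw-AlmostCommutative⟶ fromCommutativeRing R
  morphism = record
    { ⟦_⟧    = ⟦_⟧ℤ
    ; +-homo = +-homoℤ
    ; *-homo = *-homoℤ
    ; -‿homo = -‿homoℤ
    ; 0-homo = refl
    ; 1-homo = refl
    }

  -- A sound test is enough: distinct integers may coincide in the ring, and then the solver merely
  -- keeps them apart.
  coefficient≟ : ∀ i j → Maybe (⟦ i ⟧ℤ ≈ ⟦ j ⟧ℤ)
  coefficient≟ i j with i ℤ.≟ j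
  ... | yes i≡j = just (reflexive (≡.cong ⟦_⟧ℤ i≡j))
  ... | no  _   = nothing

  open RingSolver ℤ.+-*-rawRing (fromCommutativeRing R) morphism coefficient≟ public
    using (solve; con; _:=_; _:+_; _:*_; _:-_; :-_)

-- Linear dependence of n + 1 vectors with n coordinates

module LinearDependence {c ℓ} (R : CommutativeRing c ℓ)
  (_≈0? : ∀ x → Dec (CommutativeRing._≈_ R x (CommutativeRing.0# R)))
  (1≉0 : ¬ CommutativeRing._≈_ R (CommutativeRing.1# R) (CommutativeRing.0# R))
  (cancel : ∀ {x y} → ¬ CommutativeRing._≈_ R x (CommutativeRing.0# R) →
            CommutativeRing._≈_ R (CommutativeRing._*_ R x y) (CommutativeRing.0# R) →
            CommutativeRing._≈_ R y (CommutativeRing.0# R))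
  where
  open CommutativeRing R hiding (zero)
  open RingProperties ring
  open SemiringSum semiring
  open SetoidReasoning setoid
  open IntegerRingSolver R

  -- Fraction-free Gaussian elimination, by induction on the number of columns: pivots are
  -- cross-multiplied instead of inverted, so one proof serves both ℚ and the local field.
  dependence : ∀ {n} (A : Fin (suc n) → Vector Carrier n) →
    Σ[ k ∈ Vector Carrier (suc n) ]
      (∃[ i ] ¬ (k i ≈ 0#)) × (∀ j → sum (λ i → k i * A i j) ≈ 0#)
  dependence {zero}  A = (λ _ → 1#) , (zero , 1≉0) , λ ()
  dependence {suc n} A with Fin.any? (λ i → ¬? (A i zero ≈0?))
  ... | no none = k , (suc i₀ , k′i₀≉0) , k-relation
    where
    IH = dependence (λ i j → A (suc i) (suc j))
    k′ = proj₁ IH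
    i₀ = proj₁ (proj₁ (proj₂ IH))
    k′i₀≉0 = proj₂ (proj₁ (proj₂ IH))
    k = 0# ∷ k′
    column-0 : ∀ i → A i zero ≈ 0#
    column-0 i = decidable-stable (A i zero ≈0?) (λ A≉0 → none (i , A≉0))
    k-relation : ∀ j → sum (λ i → k i * A i j) ≈ 0#
    k-relation zero = begin
      sum (λ i → k i * A i zero) ≈⟨ sum-cong-≋ (λ i → trans (*-congˡ (column-0 i)) (zeroʳ (k i))) ⟩
      sum {suc (suc n)} (λ _ → 0#) ≈⟨ sum-replicate-zero (suc (suc n)) ⟩
      0# ∎
    k-relation (suc j) = begin
      0# * A zero (suc j) + sum (λ i → k′ i * A (suc i) (suc j)) ≈⟨ +-cong (zeroˡ _) (proj₂ (proj₂ IH) j) ⟩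
      0# + 0# ≈⟨ +-identityˡ 0# ⟩
      0# ∎
  ... | yes (p , P≉0) = k , (punchIn p i₀ , ki₀≉0) , k-relation
    where
    P = A p zero
    a : Vector Carrier (suc n)
    a i = A (punchIn p i) zero
    -- Scaling a row by the pivot `P` and subtracting `a i` times the pivot row clears its first
    -- entry.
    IH = dependence (λ i j → P * A (punchIn p i) (suc j) - a i * A p (suc j))
    k′ = proj₁ IH
    i₀ = proj₁ (proj₁ (proj₂ IH))
    k : Vector Carrier (suc (suc n))
    -- The coefficient of the pivot row accounts for these subtractions; `P * k′ i₀` stays nonzero
    -- by cancellation.
    k = insertAt (λ i → P * k′ i) p (- sum (λ i → k′ i * a i))
    k-punchIn : ∀ i → k (punchIn p i) ≡ P * k′ i
    k-punchIn = insertAt-punchIn (λ i → P * k′ i) p _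
    ki₀≉0 : ¬ (k (punchIn p i₀) ≈ 0#)
    ki₀≉0 k≈0 = proj₂ (proj₁ (proj₂ IH)) (cancel P≉0 (trans (reflexive (≡.sym (k-punchIn i₀))) k≈0))
    eliminate : ∀ j → sum (λ i → k i * A i j) ≈ sum (λ i → k′ i * (P * A (punchIn p i) j - a i * A p j))
    eliminate j = begin
      sum (λ i → k i * A i j)
        ≈⟨ sum-remove {i = p} (λ i → k i * A i j) ⟩
      k p * A p j + sum (λ i → k (punchIn p i) * A (punchIn p i) j)
        ≈⟨ +-cong (*-congʳ (reflexive (insertAt-lookup _ p _)))
                  (sum-cong-≋ (λ i → *-congʳ {x = A (punchIn p i) j} (reflexive (k-punchIn i)))) ⟩
      - sum (λ i → k′ i * a i) * A p j + sum (λ i → P * k′ i * A (punchIn p i) j)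
        ≈⟨ +-congʳ (trans (sym (-‿distribˡ-* _ _)) (-‿distribʳ-* _ _)) ⟩
      sum (λ i → k′ i * a i) * - A p j + sum (λ i → P * k′ i * A (punchIn p i) j)
        ≈⟨ +-congʳ (*-distribʳ-sum (- A p j) (λ i → k′ i * a i)) ⟩
      sum (λ i → k′ i * a i * - A p j) + sum (λ i → P * k′ i * A (punchIn p i) j)
        ≈⟨ ∑-distrib-+ (λ i → k′ i * a i * - A p j) (λ i → P * k′ i * A (punchIn p i) j) ⟨
      sum (λ i → k′ i * a i * - A p j + P * k′ i * A (punchIn p i) j)
        ≈⟨ sum-cong-≋ (λ i → solve 5 (λ k a A P B → k :* a :* (:- A) :+ P :* k :* B := k :* (P :* B :- a :* A)) refl
             (k′ i) (a i) (A p j) P (A (punchIn p i) j)) ⟩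
      sum (λ i → k′ i * (P * A (punchIn p i) j - a i * A p j)) ∎
    k-relation : ∀ j → sum (λ i → k i * A i j) ≈ 0#
    k-relation (suc j) = trans (eliminate (suc j)) (proj₂ (proj₂ IH) j)
    k-relation zero    = begin
      sum (λ i → k i * A i zero) ≈⟨ eliminate zero ⟩
      sum (λ i → k′ i * (P * a i - a i * P)) ≈⟨ sum-cong-≋ (λ i → solve 3 (λ k P a → k :* (P :* a :- a :* P) := con (+ 0)) refl (k′ i) P (a i)) ⟩
      sum {suc n} (λ _ → 0#) ≈⟨ sum-replicate-zero (suc n) ⟩
      0# ∎

-- Discrete valuations

private module ℤGroup = GroupProperties (AbelianGroup.group ℤ.+-0-abelianGroup)

≤∞-trans : ∀ {a b c} → a ≤∞ b → b ≤∞ c → a ≤∞ c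
≤∞-trans = ≤⁺-trans ℤ.≤-trans

≤∞-refl : ∀ {a} → a ≤∞ a
≤∞-refl = ≤⁺-reflexive-≡ ℤ.≤-reflexive ≡.refl

+∞-mono : ∀ {m n a b} → fin m ≤∞ a → fin n ≤∞ b → fin (m ℤ.+ n) ≤∞ a +∞ b
+∞-mono [ p ]     [ q ]     = [ ℤ.+-mono-≤ p q ]
+∞-mono [ p ]     (_ ≤⊤⁺) = _ ≤⊤⁺
+∞-mono (_ ≤⊤⁺) _         = _ ≤⊤⁺

-- For v(y) = v(q) + v(x) with v(x) finite and at most v(y), subtracting v(x) shows that q is
-- integral.
≤+⇒0≤ : ∀ {a b c} → a ≢ ⊤⁺ → a ≤∞ b → b ≡ c +∞ a → fin (+ 0) ≤∞ c
≤+⇒0≤ {c = ⊤⁺}        a≢∞ a≤b     _     = _ ≤⊤⁺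
≤+⇒0≤ {⊤⁺}            a≢∞ a≤b     _     = contradiction ≡.refl a≢∞
≤+⇒0≤ {fin i} {c = fin l} _ [ i≤j ] j≡l+i =
  [ ≡.subst (+ 0 ℤ.≤_) (ℤGroup.//-rightDividesʳ i l)
      (ℤ.i≤j⇒0≤j-i (≡.subst (i ℤ.≤_) ([]-injective j≡l+i) i≤j)) ]

minimum : ∀ {n} (w : Vector ℤ∞ (suc n)) → ∃[ j ] ∀ i → w j ≤∞ w i
minimum {zero}  w = zero , λ { zero → ≤∞-refl }
minimum {suc n} w with minimum (tail w)
... | j , min with ≤⁺-total ℤ.≤-total (w zero) (w (suc j))
...   | inj₁ w₀≤ = zero , λ { zero → ≤∞-refl ; (suc i) → ≤∞-trans w₀≤ (min i) }
...   | inj₂ ≤w₀ = suc j , λ { zero → ≤w₀ ; (suc i) → min i }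

module Valued {k κ₁ κ₂} (K : HeytingField k κ₁ κ₂)
  (v : Field.Carrier K → ℤ∞) (isDV : IsDiscreteValuation K v) where
  open Field K hiding (zero)
  open HeytingField K using (tight; #⇒invertible; #-irrefl)
  open IsDiscreteValuation isDV
  open RingProperties ring
  open ApartnessProperties heytingCommutativeRing using (1#0; x-0≈x)
  open IntegerRingSolver commutativeRing public

  infix 4 _∈𝔪^_

  _∈𝔪^_ : Carrier → ℕ → Set
  x ∈𝔪^ n = fin (+ n) ≤∞ v x

  𝒪 𝔪 Unit Uniformizer : Carrier → Set
  𝒪 x           = x ∈𝔪^ 0
  𝔪 x           = x ∈𝔪^ 1
  Unit x        = v x ≡ fin (+ 0)
  Uniformizer x = v x ≡ fin (+ 1)

  2# : Carrier
  2# = 1# + 1#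

  -- For integral ρ, the polynomial Y² + Y + ρ has no root in the residue field; being quadratic, it
  -- is then irreducible there.
  Irreducible : Carrier → Set k
  Irreducible ρ = ∀ {y} → 𝒪 y → ¬ 𝔪 (y * y + y + ρ)

  v≡∞⇒≈0 : ∀ {x} → v x ≡ ⊤⁺ → x ≈ 0#
  v≡∞⇒≈0 {x} vx≡∞ = proj₁ (tight x 0#) (λ x#0 → Equivalence.from v-finite x#0 vx≡∞)

  ≈0⇒v≡∞ : ∀ {x} → x ≈ 0# → v x ≡ ⊤⁺
  ≈0⇒v≡∞ {x} x≈0 with v x in eq
  ... | ⊤⁺    = ≡.refl
  ... | fin n = contradiction (Equivalence.to v-finite (λ vx≡∞ → finite≢∞ (≡.trans (≡.sym eq) vx≡∞))) (#-irrefl x≈0)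
    where finite≢∞ : fin n ≢ ⊤⁺
          finite≢∞ ()

  -- Equality in a Heyting field need not be decidable; here the valuation decides vanishing, as its
  -- value is visibly ∞ or an integer.
  _≈0? : ∀ x → Dec (x ≈ 0#)
  x ≈0? with v x in eq
  ... | ⊤⁺    = yes (v≡∞⇒≈0 eq)
  ... | fin n = no (λ x≈0 → contradiction (≡.trans (≡.sym eq) (≈0⇒v≡∞ x≈0)) λ ())

  1≉0 : ¬ (1# ≈ 0#)
  1≉0 1≈0 = #-irrefl 1≈0 1#0

  inverse : ∀ {x} → ¬ (x ≈ 0#) → ∃[ y ] x * y ≈ 1#
  inverse {x} x≉0 with #⇒invertible (Equivalence.to v-finite (λ vx≡∞ → x≉0 (v≡∞⇒≈0 vx≡∞)))
  ... | y , _ , x*y≈1 = y , trans (*-congʳ (sym (x-0≈x x))) x*y≈1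

  *-cancelˡ-0 : ∀ {x y} → ¬ (x ≈ 0#) → x * y ≈ 0# → y ≈ 0#
  *-cancelˡ-0 {x} {y} x≉0 xy≈0 with inverse x≉0
  ... | z , xz≈1 = begin
    y           ≈⟨ *-identityˡ y ⟨
    1# * y      ≈⟨ *-congʳ xz≈1 ⟨
    x * z * y   ≈⟨ solve 3 (λ x y z → x :* z :* y := z :* (x :* y)) refl x y z ⟩
    z * (x * y) ≈⟨ *-congˡ xy≈0 ⟩
    z * 0#      ≈⟨ zeroʳ z ⟩
    0#          ∎
    where open SetoidReasoning setoid

  *-≉0 : ∀ {x y} → ¬ (x ≈ 0#) → ¬ (y ≈ 0#) → ¬ (x * y ≈ 0#)
  *-≉0 x≉0 y≉0 xy≈0 = y≉0 (*-cancelˡ-0 x≉0 xy≈0)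

  ∈-resp : ∀ {x y n} → x ≈ y → x ∈𝔪^ n → y ∈𝔪^ n
  ∈-resp {n = n} x≈y = ≡.subst (fin (+ n) ≤∞_) (v-cong x≈y)

  0∈ : ∀ {n} → 0# ∈𝔪^ n
  0∈ {n} = ≡.subst (fin (+ n) ≤∞_) (≡.sym (≈0⇒v≡∞ refl)) (_ ≤⊤⁺)

  +-∈ : ∀ {x y n} → x ∈𝔪^ n → y ∈𝔪^ n → (x + y) ∈𝔪^ n
  +-∈ = v-+

  *-∈ : ∀ {x y} m n → x ∈𝔪^ m → y ∈𝔪^ n → (x * y) ∈𝔪^ (m ℕ.+ n)
  *-∈ {x} {y} m n p q = ≡.subst (fin (+ (m ℕ.+ n)) ≤∞_) (≡.sym (v-* x y)) (+∞-mono p q)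

  weaken : ∀ {x m n} → m ℕ.≤ n → x ∈𝔪^ n → x ∈𝔪^ m
  weaken m≤n = ≤∞-trans [ ℤ.+≤+ m≤n ]

  idempotent⇒0 : ∀ {i} → i ℤ.+ i ≡ i → i ≡ + 0
  idempotent⇒0 {i} = ℤGroup.identityʳ-unique i i

  double⇒0 : ∀ {i} → i ℤ.+ i ≡ + 0 → i ≡ + 0
  double⇒0 {+ zero}  _ = ≡.refl
  double⇒0 {+ suc n} ()
  double⇒0 { -[1+ n ]} ()

  1-unit : Unit 1#
  1-unit with v 1# in eq | v-* 1# 1#
  ... | ⊤⁺    | _ = contradiction (v≡∞⇒≈0 eq) 1≉0
  ... | fin n | v1*1 = ≡.cong fin (idempotent⇒0 ([]-injective (≡.sym
          (≡.trans (≡.trans (≡.sym eq) (v-cong (sym (*-identityˡ 1#)))) v1*1))))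

  -1-unit : Unit (- 1#)
  -1-unit with v (- 1#) | v-* (- 1#) (- 1#)
         | v-cong (solve 0 (:- con (+ 1) :* :- con (+ 1) := con (+ 1)) refl)
  ... | ⊤⁺    | v* | v-1*-1 = contradiction (≡.trans (≡.trans (≡.sym v*) v-1*-1) 1-unit) λ ()
  ... | fin n | v* | v-1*-1 = ≡.cong fin (double⇒0 ([]-injective (≡.trans (≡.trans (≡.sym v*) v-1*-1) 1-unit)))

  unit⇒𝒪 : ∀ {x} → Unit x → 𝒪 x
  unit⇒𝒪 ux = ≡.subst (fin (+ 0) ≤∞_) (≡.sym ux) ≤∞-refl

  uniformizer⇒𝔪 : ∀ {x} → Uniformizer x → 𝔪 x
  uniformizer⇒𝔪 px = ≡.subst (fin (+ 1) ≤∞_) (≡.sym px) ≤∞-refl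

  𝔪⇒𝒪 : ∀ {x} → 𝔪 x → 𝒪 x
  𝔪⇒𝒪 = weaken z≤n

  1∈𝒪 : 𝒪 1#
  1∈𝒪 = unit⇒𝒪 1-unit

  -‿∈ : ∀ {x n} → x ∈𝔪^ n → (- x) ∈𝔪^ n
  -‿∈ {x} {n} p = ∈-resp (solve 1 (λ x → :- con (+ 1) :* x := :- x) refl x) (*-∈ 0 n (unit⇒𝒪 -1-unit) p)

  -∈ : ∀ {x y n} → x ∈𝔪^ n → y ∈𝔪^ n → (x - y) ∈𝔪^ n
  -∈ p q = +-∈ p (-‿∈ q)

  unit∉𝔪 : ∀ {x} → Unit x → ¬ 𝔪 x
  unit∉𝔪 ux mx with ≡.subst (fin (+ 1) ≤∞_) ux mx
  ... | [ ℤ.+≤+ () ]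

  finite≉0 : ∀ {x n} → v x ≡ fin n → ¬ (x ≈ 0#)
  finite≉0 vx x≈0 = contradiction (≡.trans (≡.sym vx) (≈0⇒v≡∞ x≈0)) λ ()

  ∈∖∈⇒v : ∀ {x n} → x ∈𝔪^ n → ¬ (x ∈𝔪^ suc n) → v x ≡ fin (+ n)
  ∈∖∈⇒v {x} {n} p q with v x
  ... | ⊤⁺ = contradiction (_ ≤⊤⁺) q
  ... | fin i with p
  ...   | [ ℤ.+≤+ {n = j} n≤j ] with ℕ.m≤n⇒m<n∨m≡n n≤j
  ...     | inj₁ n<j = contradiction [ ℤ.+≤+ n<j ] q
  ...     | inj₂ ≡.refl = ≡.refl

  -- The order on values is decidable. For `n = 0` this is the dichotomy between non-units and units
  -- of the local ring 𝒪.
  𝔪⊎v : ∀ {x n} → x ∈𝔪^ n → x ∈𝔪^ suc n ⊎ v x ≡ fin (+ n)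
  𝔪⊎v {x} {n} p with ≤⁺-dec ℤ._≤?_ (fin (+ suc n)) (v x)
  ... | yes q = inj₁ q
  ... | no ¬q = inj₂ (∈∖∈⇒v p ¬q)

  *-unit : ∀ {x y} → Unit x → Unit y → Unit (x * y)
  *-unit {x} {y} ux uy = ≡.trans (v-* x y) (≡.cong₂ _+∞_ ux uy)

  divide : ∀ {x y} → ¬ (x ≈ 0#) → v x ≤∞ v y → ∃[ q ] 𝒪 q × y ≈ q * x
  divide {x} {y} x≉0 vx≤vy with inverse x≉0
  ... | z , xz≈1 = y * z , ≤+⇒0≤ (λ vx≡∞ → x≉0 (v≡∞⇒≈0 vx≡∞)) vx≤vy (≡.trans (v-cong y≈yzx) (v-* (y * z) x)) , y≈yzx
    where
    y≈yzx : y ≈ y * z * x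
    y≈yzx = begin
      y           ≈⟨ *-identityʳ y ⟨
      y * 1#      ≈⟨ *-congˡ xz≈1 ⟨
      y * (x * z) ≈⟨ solve 3 (λ x y z → y :* (x :* z) := y :* z :* x) refl x y z ⟩
      y * z * x   ∎
      where open SetoidReasoning setoid

  factor : ∀ {p x} n → v p ≡ fin (+ n) → x ∈𝔪^ n → ∃[ q ] 𝒪 q × x ≈ q * p
  factor {x = x} n vp x∈ = divide (finite≉0 vp) (≡.subst (_≤∞ v x) (≡.sym vp) x∈)

  unit-inverse : ∀ {x} → Unit x → ∃[ y ] 𝒪 y × x * y ≈ 1#
  unit-inverse {x} ux with factor 0 ux 1∈𝒪
  ... | y , y∈𝒪 , 1≈yx = y , y∈𝒪 , trans (*-comm x y) (sym 1≈yx)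

  -- A coordinate of least value is nonzero and divides all the others, so every nonzero vector is a
  -- multiple of an integral one with a coordinate 1.
  scale : ∀ {n} (a : Vector Carrier (suc n)) → (∃[ i ] ¬ (a i ≈ 0#)) →
    Σ[ j ∈ Fin (suc n) ] (¬ (a j ≈ 0#)) × ∀ i → ∃[ q ] 𝒪 q × a i ≈ q * a j
  scale a (i , ai≉0) with minimum (λ i → v (a i))
  ... | j , min = j , aj≉0 , λ i → divide aj≉0 (min i)
    where
    aj≉0 : ¬ (a j ≈ 0#)
    aj≉0 aj≈0 with ≡.subst (_≤∞ v (a i)) (≈0⇒v≡∞ aj≈0) (min i)
    ... | p with v (a i) in eq
    ...   | ⊤⁺ = ai≉0 (v≡∞⇒≈0 eq)
    aj≉0 aj≈0 | () | fin _

  unit-cong : ∀ {x y} → x ≈ y → Unit x → Unit y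
  unit-cong x≈y ux = ≡.trans (≡.sym (v-cong x≈y)) ux

  *-unit-uniformizer : ∀ {x p} → Unit x → Uniformizer p → Uniformizer (p * x)
  *-unit-uniformizer {x} {p} ux up = ≡.trans (v-* p x) (≡.cong₂ _+∞_ up ux)

  uniformizer∉𝔪² : ∀ {p} → Uniformizer p → ¬ (p ∈𝔪^ 2)
  uniformizer∉𝔪² up p∈ with ≡.subst (fin (+ 2) ≤∞_) up p∈
  ... | [ ℤ.+≤+ (s≤s ()) ]

  ≈1 : ∀ {x d} → ¬ (d ≈ 0#) → x * d ≈ d → x ≈ 1#
  ≈1 {x} {d} d≉0 xd≈d = x∙y⁻¹≈ε⇒x≈y _ _ (*-cancelˡ-0 d≉0 (begin
    d * (x - 1#) ≈⟨ solve 2 (λ x d → d :* (x :- con (+ 1)) := x :* d :- d) refl x d ⟩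
    x * d - d    ≈⟨ +-congʳ xd≈d ⟩
    d - d        ≈⟨ -‿inverseʳ d ⟩
    0#           ∎))
    where
    open SetoidReasoning setoid

  1-𝔪-unit : ∀ {x} → 𝔪 x → Unit (1# - x)
  1-𝔪-unit {x} x∈ with 𝔪⊎v (-∈ 1∈𝒪 (𝔪⇒𝒪 x∈))
  ... | inj₂ unit = unit
  ... | inj₁ 1-x∈ = contradiction
          (∈-resp (solve 1 (λ x → con (+ 1) :- x :+ x := con (+ 1)) refl x) (+-∈ 1-x∈ x∈)) (unit∉𝔪 1-unit)

  -- Normalised primitivity: some coordinate is 1 itself and not merely a unit.
  Primitive : Carrier → Carrier → Set _
  Primitive s t = (𝒪 s × 𝒪 t) × (s ≈ 1# ⊎ t ≈ 1#)

  -- The coefficient of smaller value divides the other one. The lemma finds, in a binary lattice, a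
  -- primitive vector orthogonal to a given vector.
  primitive-kernel : ∀ a b → ∃[ s ] ∃[ t ] Primitive s t × s * a + t * b ≈ 0#
  primitive-kernel a b with ≤⁺-total ℤ.≤-total (v a) (v b) | a ≈0? | b ≈0?
  ... | _ | yes a≈0 | _ = 1# , 0# , ((1∈𝒪 , 0∈) , inj₁ refl) ,
          trans (+-cong (trans (*-congˡ a≈0) (zeroʳ 1#)) (zeroˡ b)) (+-identityˡ 0#)
  ... | _ | no _ | yes b≈0 = 0# , 1# , ((0∈ , 1∈𝒪) , inj₂ refl) ,
          trans (+-cong (zeroˡ a) (trans (*-congˡ b≈0) (zeroʳ 1#))) (+-identityˡ 0#)
  ... | inj₁ va≤vb | no a≉0 | no _ with divide a≉0 va≤vb
  ...   | q , q∈ , b≈qa = - q , 1# , ((-‿∈ q∈ , 1∈𝒪) , inj₂ refl) ,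
          trans (+-congˡ (*-congˡ b≈qa)) (solve 2 (λ q a → :- q :* a :+ con (+ 1) :* (q :* a) := con (+ 0)) refl q a)
  primitive-kernel a b | inj₂ vb≤va | no _ | no b≉0 with divide b≉0 vb≤va
  ...   | q , q∈ , a≈qb = 1# , - q , ((1∈𝒪 , -‿∈ q∈) , inj₁ refl) ,
          trans (+-congʳ (*-congˡ a≈qb)) (solve 2 (λ q a → con (+ 1) :* (q :* a) :+ :- q :* a := con (+ 0)) refl q b)

-- Anisotropic quaternary forms

module ArtinSchreier {k κ₁ κ₂} (K : HeytingField k κ₁ κ₂)
  (v : Field.Carrier K → ℤ∞) (isDV : IsDiscreteValuation K v)
  (ρ : Field.Carrier K) (ρ∈𝒪 : Valued.𝒪 K v isDV ρ) (irreducible : Valued.Irreducible K v isDV ρ)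
  where
  open Field K hiding (zero)
  open Valued K v isDV
  open RingProperties ring
  open SetoidReasoning setoid

  -- The norm of x - yθ, where θ is a root of X² + X + ρ.
  N : Carrier → Carrier → Carrier
  N x y = x * x + x * y + ρ * (y * y)

  N-∈ : ∀ {x y n} → x ∈𝔪^ n → y ∈𝔪^ n → N x y ∈𝔪^ (n ℕ.+ n)
  N-∈ {n = n} x∈ y∈ = +-∈ (+-∈ (*-∈ n n x∈ x∈) (*-∈ n n x∈ y∈)) (*-∈ 0 (n ℕ.+ n) ρ∈𝒪 (*-∈ n n y∈ y∈))

  -- If y is a unit, division by y² makes x/y a root of Y² + Y + ρ modulo 𝔪. If y lies in 𝔪, then
  -- N(x,y) ≡ x² modulo 𝔪, so x is not a unit.
  N-anisotropic : ∀ {x y} → 𝒪 x → 𝒪 y → 𝔪 (N x y) → 𝔪 x × 𝔪 y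
  N-anisotropic {x} {y} x∈ y∈ N∈ with 𝔪⊎v y∈
  ... | inj₂ y-unit = contradiction (∈-resp factored (*-∈ 0 1 (*-∈ 0 0 y⁻¹∈ y⁻¹∈) N∈)) (irreducible (*-∈ 0 0 x∈ y⁻¹∈))
    where
    y⁻¹ = proj₁ (unit-inverse y-unit)
    y⁻¹∈ = proj₁ (proj₂ (unit-inverse y-unit))
    yy⁻¹≈1 = proj₂ (proj₂ (unit-inverse y-unit))
    factored : y⁻¹ * y⁻¹ * N x y ≈ (x * y⁻¹) * (x * y⁻¹) + x * y⁻¹ + ρ
    factored = begin
      y⁻¹ * y⁻¹ * N x y
        ≈⟨ solve 4 (λ x y z ρ → z :* z :* (x :* x :+ x :* y :+ ρ :* (y :* y)) :=
             (x :* z) :* (x :* z) :+ x :* z :* (y :* z) :+ ρ :* ((y :* z) :* (y :* z))) refl x y y⁻¹ ρ ⟩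
      (x * y⁻¹) * (x * y⁻¹) + x * y⁻¹ * (y * y⁻¹) + ρ * ((y * y⁻¹) * (y * y⁻¹))
        ≈⟨ +-cong (+-congˡ (*-congˡ yy⁻¹≈1)) (*-congˡ (*-cong yy⁻¹≈1 yy⁻¹≈1)) ⟩
      (x * y⁻¹) * (x * y⁻¹) + x * y⁻¹ * 1# + ρ * (1# * 1#)
        ≈⟨ +-cong (+-congˡ (*-identityʳ _)) (trans (*-congˡ (*-identityˡ 1#)) (*-identityʳ ρ)) ⟩
      (x * y⁻¹) * (x * y⁻¹) + x * y⁻¹ + ρ ∎
  ... | inj₁ y∈𝔪 with 𝔪⊎v x∈
  ...   | inj₁ x∈𝔪 = x∈𝔪 , y∈𝔪
  ...   | inj₂ x-unit = contradiction
          (∈-resp (solve 3 (λ x y ρ → (x :* x :+ x :* y :+ ρ :* (y :* y)) :- (x :+ ρ :* y) :* y := x :* x) refl x y ρ)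
            (-∈ N∈ (*-∈ 0 1 (+-∈ x∈ (*-∈ 0 0 ρ∈𝒪 y∈)) y∈𝔪)))
          (unit∉𝔪 (*-unit x-unit x-unit))

  module Quaternary {u p} (u-unit : Unit u) (p-uniformizer : Uniformizer p)
    {k₁ k₂ k₃ k₄} (k₁∈ : 𝔪 k₁) (k₂∈ : 𝔪 k₂) (k₃∈ : 𝔪 k₃) (k₄∈ : 𝔪 k₄) where

    X : (x y z w : Carrier) → Carrier
    X x y z w = k₁ * (x * z) + k₂ * (x * w) + (k₃ * (y * z) + k₄ * (y * w))

    -- Without the cross terms `X` this is uN ⊥ pN, up to a scalar the norm form of a quaternion
    -- division algebra. Cross terms with coefficients in 𝔪 leave the anisotropy intact.
    E : (x y z w : Carrier) → Carrier
    E x y z w = u * N x y + p * N z w + X x y z w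

    p∈𝔪 = uniformizer⇒𝔪 p-uniformizer

    X-∈ : ∀ {x y z w m n} → x ∈𝔪^ m → y ∈𝔪^ m → z ∈𝔪^ n → w ∈𝔪^ n → X x y z w ∈𝔪^ suc (m ℕ.+ n)
    X-∈ {m = m} {n} x∈ y∈ z∈ w∈ =
      +-∈ (+-∈ (*-∈ 1 (m ℕ.+ n) k₁∈ (*-∈ m n x∈ z∈)) (*-∈ 1 (m ℕ.+ n) k₂∈ (*-∈ m n x∈ w∈)))
          (+-∈ (*-∈ 1 (m ℕ.+ n) k₃∈ (*-∈ m n y∈ z∈)) (*-∈ 1 (m ℕ.+ n) k₄∈ (*-∈ m n y∈ w∈)))

    -- Modulo 𝔪 only uN(x,y) survives, so x and y lie in 𝔪. Then uN(x,y) and the cross terms lie in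
    -- 𝔪², hence so does pN(z,w), and N(z,w) is not a unit.
    E≈0⇒𝔪 : ∀ {x y z w} → 𝒪 x → 𝒪 y → 𝒪 z → 𝒪 w → E x y z w ≈ 0# → (𝔪 x × 𝔪 y) × (𝔪 z × 𝔪 w)
    E≈0⇒𝔪 {x} {y} {z} {w} x∈ y∈ z∈ w∈ E≈0 = xy∈ , zw∈
      where
      u⁻¹ = proj₁ (unit-inverse u-unit)
      u⁻¹∈ = proj₁ (proj₂ (unit-inverse u-unit))
      Nxy : u⁻¹ * - (p * N z w + X x y z w) ≈ N x y
      Nxy = begin
        u⁻¹ * - (p * N z w + X x y z w) ≈⟨ *-congˡ (+-identityˡ _) ⟨
        u⁻¹ * (0# - (p * N z w + X x y z w)) ≈⟨ *-congˡ (+-congʳ E≈0) ⟨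
        u⁻¹ * (E x y z w - (p * N z w + X x y z w))
          ≈⟨ solve 5 (λ u u′ n m x → u′ :* ((u :* n :+ m :+ x) :- (m :+ x)) := (u :* u′) :* n) refl
               u u⁻¹ (N x y) (p * N z w) (X x y z w) ⟩
        (u * u⁻¹) * N x y ≈⟨ *-congʳ (proj₂ (proj₂ (unit-inverse u-unit))) ⟩
        1# * N x y ≈⟨ *-identityˡ _ ⟩
        N x y ∎
      xy∈ : 𝔪 x × 𝔪 y
      xy∈ = N-anisotropic x∈ y∈ (∈-resp Nxy (*-∈ 0 1 u⁻¹∈ (-‿∈ (+-∈ (*-∈ 1 0 p∈𝔪 (N-∈ z∈ w∈)) (X-∈ x∈ y∈ z∈ w∈)))))
      pN∈ : (p * N z w) ∈𝔪^ 2
      pN∈ = ∈-resp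
        (solve 3 (λ n m x → (n :+ m :+ x) :- (n :+ x) := m) refl (u * N x y) (p * N z w) (X x y z w))
        (-∈ (∈-resp (sym E≈0) 0∈) (+-∈ (*-∈ 0 2 (unit⇒𝒪 u-unit) (N-∈ (proj₁ xy∈) (proj₂ xy∈))) (X-∈ (proj₁ xy∈) (proj₂ xy∈) z∈ w∈)))
      zw∈ : 𝔪 z × 𝔪 w
      zw∈ with 𝔪⊎v (N-∈ z∈ w∈)
      ... | inj₁ N∈ = N-anisotropic z∈ w∈ N∈
      ... | inj₂ N-unit = contradiction pN∈ (uniformizer∉𝔪² (*-unit-uniformizer N-unit p-uniformizer))

    E-cong : ∀ {x y z w x′ y′ z′ w′} → x ≈ x′ → y ≈ y′ → z ≈ z′ → w ≈ w′ → E x y z w ≈ E x′ y′ z′ w′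
    E-cong x y z w = +-cong (+-cong (*-congˡ (N-cong x y)) (*-congˡ (N-cong z w)))
        (+-cong (+-cong (*-congˡ (*-cong x z)) (*-congˡ (*-cong x w))) (+-cong (*-congˡ (*-cong y z)) (*-congˡ (*-cong y w))))
      where
      N-cong : ∀ {x y x′ y′} → x ≈ x′ → y ≈ y′ → N x y ≈ N x′ y′
      N-cong x y = +-cong (+-cong (*-cong x x) (*-cong x y)) (*-congˡ (*-cong y y))

    E-homogeneous : ∀ d x y z w → E (x * d) (y * d) (z * d) (w * d) ≈ d * d * E x y z w
    E-homogeneous d x y z w = begin
      E (x * d) (y * d) (z * d) (w * d)
        ≈⟨ +-cong (+-cong (*-congˡ (N-homogeneous x y)) (*-congˡ (N-homogeneous z w)))
             (solve 9 (λ d x y z w k₁ k₂ k₃ k₄ →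
               k₁ :* (x :* d :* (z :* d)) :+ k₂ :* (x :* d :* (w :* d)) :+ (k₃ :* (y :* d :* (z :* d)) :+ k₄ :* (y :* d :* (w :* d)))
               := d :* d :* (k₁ :* (x :* z) :+ k₂ :* (x :* w) :+ (k₃ :* (y :* z) :+ k₄ :* (y :* w)))) refl d x y z w k₁ k₂ k₃ k₄) ⟩
      u * (d * d * N x y) + p * (d * d * N z w) + d * d * X x y z w
        ≈⟨ solve 6 (λ u p d n m x → u :* (d :* n) :+ p :* (d :* m) :+ d :* x := d :* (u :* n :+ p :* m :+ x)) refl
             u p (d * d) (N x y) (N z w) (X x y z w) ⟩
      d * d * E x y z w ∎
      where
      N-homogeneous : ∀ x y → N (x * d) (y * d) ≈ d * d * N x y
      N-homogeneous x y = solve 4 (λ d x y ρ → x :* d :* (x :* d) :+ x :* d :* (y :* d) :+ ρ :* (y :* d :* (y :* d))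
        := d :* d :* (x :* x :+ x :* y :+ ρ :* (y :* y))) refl d x y ρ

    -- By homogeneity a nontrivial zero can be divided by its coordinate of least value. The
    -- quotient is an integral zero with a coordinate 1, which `E≈0⇒𝔪` forbids.
    E-anisotropic : ∀ {x y z w} → E x y z w ≈ 0# → (x ≈ 0# × y ≈ 0#) × (z ≈ 0# × w ≈ 0#)
    E-anisotropic {x} {y} {z} {w} E≈0 = (a≈0 0F , a≈0 1F) , (a≈0 2F , a≈0 3F)
      where
      a : Vector Carrier 4
      a = x ∷ y ∷ z ∷ w ∷ []
      a≈0 : ∀ i → a i ≈ 0#
      a≈0 i = decidable-stable (a i ≈0?) λ ai≉0 → nonzero⇒⊥ (i , ai≉0)
        where
        nonzero⇒⊥ : ¬ (∃[ i ] ¬ (a i ≈ 0#))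
        nonzero⇒⊥ nonzero = contradiction (q∈𝔪 j) (unit∉𝔪 qj-unit)
          where
          j = proj₁ (scale a nonzero)
          d = a j
          d≉0 = proj₁ (proj₂ (scale a nonzero))
          q : Fin 4 → Carrier
          q i = proj₁ (proj₂ (proj₂ (scale a nonzero)) i)
          q∈ : ∀ i → 𝒪 (q i)
          q∈ i = proj₁ (proj₂ (proj₂ (proj₂ (scale a nonzero)) i))
          a≈qd : ∀ i → a i ≈ q i * d
          a≈qd i = proj₂ (proj₂ (proj₂ (proj₂ (scale a nonzero)) i))
          Eq≈0 : E (q 0F) (q 1F) (q 2F) (q 3F) ≈ 0#
          Eq≈0 = *-cancelˡ-0 (*-≉0 d≉0 d≉0) (begin
            d * d * E (q 0F) (q 1F) (q 2F) (q 3F) ≈⟨ E-homogeneous d _ _ _ _ ⟨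
            E (q 0F * d) (q 1F * d) (q 2F * d) (q 3F * d) ≈⟨ E-cong (a≈qd 0F) (a≈qd 1F) (a≈qd 2F) (a≈qd 3F) ⟨
            E x y z w ≈⟨ E≈0 ⟩
            0# ∎)
          q∈𝔪 : ∀ i → 𝔪 (q i)
          q∈𝔪 = let (x∈ , y∈) , (z∈ , w∈) = E≈0⇒𝔪 (q∈ 0F) (q∈ 1F) (q∈ 2F) (q∈ 3F) Eq≈0 in
            λ { 0F → x∈ ; 1F → y∈ ; 2F → z∈ ; 3F → w∈ }
          qj-unit : Unit (q j)
          qj-unit = unit-resp (≈1 d≉0 (sym (a≈qd j)))
            where
            unit-resp : ∀ {x} → x ≈ 1# → Unit x
            unit-resp x≈1 = unit-cong (sym x≈1) 1-unit

-- Unit multiples of a binary form that share no nonzero value with it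

module BinarySimilarity {k κ₁ κ₂} (K : HeytingField k κ₁ κ₂)
  (v : Field.Carrier K → ℤ∞) (isDV : IsDiscreteValuation K v)
  (2∈𝔪 : Valued.𝔪 K v isDV (Valued.2# K v isDV))
  (2≉0 : ¬ Field._≈_ K (Valued.2# K v isDV) (Field.0# K))
  (ρ : Field.Carrier K) (ρ∈𝒪 : Valued.𝒪 K v isDV ρ) (irreducible : Valued.Irreducible K v isDV ρ)
  {u p c : Field.Carrier K} (u-unit : Valued.Unit K v isDV u)
  (p-uniformizer : Valued.Uniformizer K v isDV p) (c∈𝒪 : Valued.𝒪 K v isDV c)
  where
  open Field K hiding (zero)
  open Valued K v isDV
  open ArtinSchreier K v isDV ρ ρ∈𝒪 irreducible
  open RingProperties ring
  open SetoidReasoning setoid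

  q : Carrier → Carrier → Carrier
  q s t = u * (s * s) + 2# * (c * (s * t)) + p * (t * t)

  q-cong : ∀ {s t s′ t′} → s ≈ s′ → t ≈ t′ → q s t ≈ q s′ t′
  q-cong s t = +-cong (+-cong (*-congˡ (*-cong s s)) (*-congˡ (*-congˡ (*-cong s t)))) (*-congˡ (*-cong t t))

  private
    h = proj₁ (inverse 2≉0)
    2h≈1 = proj₂ (inverse 2≉0)

    -- `h` is 1/2, so h(s - z) need not be integral. This is harmless because `E-anisotropic` holds
    -- over the whole field.
    halve : ∀ s z → s ≈ z + 2# * (h * (s - z))
    halve s z = begin
      s                          ≈⟨ solve 2 (λ s z → s := z :+ con (+ 1) :* (s :- z)) refl s z ⟩
      z + 1# * (s - z)           ≈⟨ +-congˡ (*-congʳ 2h≈1) ⟨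
      z + 2# * h * (s - z)       ≈⟨ +-congˡ (*-assoc _ _ _) ⟩
      z + 2# * (h * (s - z))     ∎

    -- Polarisation: a shift by 2(S,T) adds four times the pairing of (z,w) with (S,T) and four
    -- times q(S,T). Besides βq(z,w) everything carries the factor 4, and β is chosen later so that
    -- this term does too.
    q-difference : ∀ β S T z w →
      q (z + 2# * S) (w + 2# * T) - (1# - β) * q z w ≈
      2# * 2# * (u * (S * S) + 2# * (c * (S * T)) + p * (T * T)
        + (S * (u * z) + S * (c * w) + (T * (c * z) + T * (p * w)))) + β * q z w
    q-difference β S T z w = solve 8 (λ u c p β S T z w →
      let q s t = u :* (s :* s) :+ con (+ 2) :* (c :* (s :* t)) :+ p :* (t :* t) in
      q (z :+ con (+ 2) :* S) (w :+ con (+ 2) :* T) :- (con (+ 1) :- β) :* q z w :=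
      con (+ 2) :* con (+ 2) :* (u :* (S :* S) :+ con (+ 2) :* (c :* (S :* T)) :+ p :* (T :* T)
        :+ (S :* (u :* z) :+ S :* (c :* w) :+ (T :* (c :* z) :+ T :* (p :* w)))) :+ β :* q z w)
      refl u c p β S T z w

    4≉0 : ¬ (2# * 2# ≈ 0#)
    4≉0 = *-≉0 2≉0 2≉0

  -- Anisotropy of the quaternary form q ⊥ -lq, with the two halves on opposite sides of an
  -- equation.
  Dissimilar : Carrier → Set _
  Dissimilar l = ∀ {s t z w} → q s t ≈ l * q z w → (s ≈ 0# × t ≈ 0#) × (z ≈ 0# × w ≈ 0#)

  private
    zero-sum : ∀ s z → h * (s - z) ≈ 0# → z ≈ 0# → s ≈ 0#
    zero-sum s z hs≈0 z≈0 = begin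
      s                        ≈⟨ halve s z ⟩
      z + 2# * (h * (s - z))   ≈⟨ +-cong z≈0 (*-congˡ hs≈0) ⟩
      0# + 2# * 0#             ≈⟨ trans (+-identityˡ _) (zeroʳ 2#) ⟩
      0#                       ∎

    difference⇒dissimilar : ∀ β →
      (∀ {S T z w} → q (z + 2# * S) (w + 2# * T) - (1# - β) * q z w ≈ 0# → (S ≈ 0# × T ≈ 0#) × (z ≈ 0# × w ≈ 0#)) →
      Dissimilar (1# - β)
    difference⇒dissimilar β anisotropic {s} {t} {z} {w} eq =
      let (S≈0 , T≈0) , (z≈0 , w≈0) = anisotropic (begin
            q (z + 2# * (h * (s - z))) (w + 2# * (h * (t - w))) - (1# - β) * q z w
              ≈⟨ +-congʳ (q-cong (halve s z) (halve t w)) ⟨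
            q s t - (1# - β) * q z w             ≈⟨ +-congʳ eq ⟩
            (1# - β) * q z w - (1# - β) * q z w  ≈⟨ -‿inverseʳ _ ⟩
            0#                                   ∎)
      in (zero-sum s z S≈0 z≈0 , zero-sum t w T≈0 w≈0) , (z≈0 , w≈0)

  -- In both cases l = 1 - β, s = z + 2S and t = w + 2T, and the difference of the two sides is 4E. Here
  -- l = 1 - 4ρ, whose square root generates the unramified quadratic extension.
  dissimilar-𝔪 : 𝔪 c → ∃[ l ] Unit l × Dissimilar l
  dissimilar-𝔪 c∈𝔪 =
    1# - β , 1-𝔪-unit (*-∈ 1 0 (*-∈ 1 0 2∈𝔪 (𝔪⇒𝒪 2∈𝔪)) ρ∈𝒪) , difference⇒dissimilar β anisotropic
    where
    β = 2# * 2# * ρ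
    -- Pairing S with z and T with w produces uN(S,z) and pN(T,w); each of the four cross terms left
    -- over contains c, which lies in 𝔪.
    open Quaternary u-unit p-uniformizer
      {2# * c} {c} {c} {2# * ρ * c} (*-∈ 1 0 2∈𝔪 c∈𝒪) c∈𝔪 c∈𝔪 (*-∈ 1 0 (*-∈ 1 0 2∈𝔪 ρ∈𝒪) c∈𝒪)
    4E : ∀ S T z w → q (z + 2# * S) (w + 2# * T) - (1# - β) * q z w ≈ 2# * 2# * E S z T w
    4E S T z w = trans (q-difference β S T z w) (solve 8 (λ u c p ρ S T z w →
      let 2̂ = con (+ 2) ; q s t = u :* (s :* s) :+ 2̂ :* (c :* (s :* t)) :+ p :* (t :* t)
          N x y = x :* x :+ x :* y :+ ρ :* (y :* y) in
      2̂ :* 2̂ :* (u :* (S :* S) :+ 2̂ :* (c :* (S :* T)) :+ p :* (T :* T)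
        :+ (S :* (u :* z) :+ S :* (c :* w) :+ (T :* (c :* z) :+ T :* (p :* w)))) :+ 2̂ :* 2̂ :* ρ :* q z w :=
      2̂ :* 2̂ :* (u :* N S z :+ p :* N T w
        :+ (2̂ :* c :* (S :* T) :+ c :* (S :* w) :+ (c :* (z :* T) :+ 2̂ :* ρ :* c :* (z :* w)))))
      refl u c p ρ S T z w)
    anisotropic : ∀ {S T z w} → q (z + 2# * S) (w + 2# * T) - (1# - β) * q z w ≈ 0# →
      (S ≈ 0# × T ≈ 0#) × (z ≈ 0# × w ≈ 0#)
    anisotropic {S} {T} {z} {w} D≈0 =
      let (S≈0 , z≈0) , (T≈0 , w≈0) = E-anisotropic (*-cancelˡ-0 4≉0 (trans (sym (4E S T z w)) D≈0))
      in (S≈0 , T≈0) , (z≈0 , w≈0)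

  -- Here β = 4ρc²/(up), chosen so that after z = (p/c)Z and w = (u/c)W the terms in S, W and those in T, Z
  -- complete to uN(S,W) and pN(T,Z).
  dissimilar-unit : Unit c → ∃[ l ] Unit l × Dissimilar l
  dissimilar-unit c-unit = 1# - β , 1-𝔪-unit β∈𝔪 , difference⇒dissimilar β anisotropic
    where
    c⁻¹ = proj₁ (unit-inverse c-unit)
    c⁻¹∈ = proj₁ (proj₂ (unit-inverse c-unit))
    cc⁻¹≈1 = proj₂ (proj₂ (unit-inverse c-unit))
    u⁻¹ = proj₁ (unit-inverse u-unit)
    u⁻¹∈ = proj₁ (proj₂ (unit-inverse u-unit))
    uu⁻¹≈1 = proj₂ (proj₂ (unit-inverse u-unit))
    p≉0 = finite≉0 p-uniformizer
    p⁻¹ = proj₁ (inverse p≉0)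
    pp⁻¹≈1 = proj₂ (inverse p≉0)
    -- Writing 2 = τp turns 4ρc²/(up) into 2τρc²/u, where the division by p has disappeared and
    -- membership in 𝔪 is visible.
    τ = proj₁ (factor 1 p-uniformizer 2∈𝔪)
    τ∈ = proj₁ (proj₂ (factor 1 p-uniformizer 2∈𝔪))
    2≈τp = proj₂ (proj₂ (factor 1 p-uniformizer 2∈𝔪))
    β = 2# * τ * ρ * (c * c) * u⁻¹
    β∈𝔪 : 𝔪 β
    β∈𝔪 = *-∈ 1 0 (*-∈ 1 0 (*-∈ 1 0 (*-∈ 1 0 2∈𝔪 τ∈) ρ∈𝒪) (*-∈ 0 0 c∈𝒪 c∈𝒪)) u⁻¹∈
    -- In the new variables uz = gZ and pw = gW, so g is the coefficient of the cross terms SZ and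
    -- TW.
    g = u * p * c⁻¹
    g∈𝔪 : 𝔪 g
    g∈𝔪 = *-∈ 1 0 (*-∈ 0 1 (unit⇒𝒪 u-unit) (uniformizer⇒𝔪 p-uniformizer)) c⁻¹∈
    open Quaternary u-unit p-uniformizer
      {2# * c} {g} {g} {2# * ρ * c} (*-∈ 1 0 2∈𝔪 c∈𝒪) g∈𝔪 g∈𝔪 (*-∈ 1 0 (*-∈ 1 0 2∈𝔪 ρ∈𝒪) c∈𝒪)

    βupc⁻² : β * (u * p) * (c⁻¹ * c⁻¹) ≈ 2# * 2# * ρ
    βupc⁻² = begin
      β * (u * p) * (c⁻¹ * c⁻¹)
        ≈⟨ solve 7 (λ τ ρ c u′ u p c′ → con (+ 2) :* τ :* ρ :* (c :* c) :* u′ :* (u :* p) :* (c′ :* c′) :=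
             con (+ 2) :* (τ :* p) :* ρ :* ((c :* c′) :* (c :* c′) :* (u :* u′))) refl τ ρ c u⁻¹ u p c⁻¹ ⟩
      2# * (τ * p) * ρ * ((c * c⁻¹) * (c * c⁻¹) * (u * u⁻¹))
        ≈⟨ *-cong (*-congʳ (*-congˡ (sym 2≈τp))) (*-cong (*-cong cc⁻¹≈1 cc⁻¹≈1) uu⁻¹≈1) ⟩
      2# * 2# * ρ * (1# * 1# * 1#)
        ≈⟨ solve 1 (λ x → x :* (con (+ 1) :* con (+ 1) :* con (+ 1)) := x) refl (2# * 2# * ρ) ⟩
      2# * 2# * ρ ∎

    cancelˡ : ∀ {a b} x → a * b ≈ 1# → a * (b * x) ≈ x
    cancelˡ x ab≈1 = trans (sym (*-assoc _ _ x)) (trans (*-congʳ ab≈1) (*-identityˡ x))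

    anisotropic : ∀ {S T z w} → q (z + 2# * S) (w + 2# * T) - (1# - β) * q z w ≈ 0# →
      (S ≈ 0# × T ≈ 0#) × (z ≈ 0# × w ≈ 0#)
    anisotropic {S} {T} {z} {w} D≈0 =
      let (S≈0 , W≈0) , (T≈0 , Z≈0) = E-anisotropic (*-cancelˡ-0 4≉0 (trans (sym 4E) D≈0))
      in (S≈0 , T≈0) ,
         ( trans z≈ (trans (*-congˡ (trans (*-congˡ Z≈0) (zeroʳ p))) (zeroʳ c⁻¹))
         , trans w≈ (trans (*-congˡ (trans (*-congˡ W≈0) (zeroʳ u))) (zeroʳ c⁻¹)))
      where
      Z = p⁻¹ * (c * z)
      W = u⁻¹ * (c * w)
      cz≈pZ : c * z ≈ p * Z
      cz≈pZ = sym (cancelˡ (c * z) pp⁻¹≈1)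
      cw≈uW : c * w ≈ u * W
      cw≈uW = sym (cancelˡ (c * w) uu⁻¹≈1)
      c⁻¹c≈1 = trans (*-comm c⁻¹ c) cc⁻¹≈1
      z≈ : z ≈ c⁻¹ * (p * Z)
      z≈ = trans (sym (cancelˡ z c⁻¹c≈1)) (*-congˡ cz≈pZ)
      w≈ : w ≈ c⁻¹ * (u * W)
      w≈ = trans (sym (cancelˡ w c⁻¹c≈1)) (*-congˡ cw≈uW)
      uz≈gZ : u * z ≈ g * Z
      uz≈gZ = trans (*-congˡ z≈) (solve 4 (λ u c p Z → u :* (c :* (p :* Z)) := u :* p :* c :* Z) refl u c⁻¹ p Z)
      pw≈gW : p * w ≈ g * W
      pw≈gW = trans (*-congˡ w≈) (solve 4 (λ u c p W → p :* (c :* (u :* W)) := u :* p :* c :* W) refl u c⁻¹ p W)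
      -- The substitution gives q(z,w) = (up/c²)(pZ² + 2cZW + uW²): u and p change places, so that W
      -- is paired with S and Z with T.
      βq≈ : β * q z w ≈ 2# * 2# * ρ * (p * (Z * Z) + 2# * (c * (Z * W)) + u * (W * W))
      βq≈ = begin
        β * q z w
          ≈⟨ *-congˡ (+-cong (+-cong (*-congˡ (*-cong z≈ z≈)) (*-congˡ (trans (sym (*-assoc c z w)) (*-cong cz≈pZ w≈)))) (*-congˡ (*-cong w≈ w≈))) ⟩
        β * (u * ((c⁻¹ * (p * Z)) * (c⁻¹ * (p * Z))) + 2# * (p * Z * (c⁻¹ * (u * W))) + p * ((c⁻¹ * (u * W)) * (c⁻¹ * (u * W))))
          -- The middle term has one factor `c⁻¹` fewer than the outer ones; inserting `c * c⁻¹`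
          -- lets `c⁻¹ * c⁻¹` be taken out of all three.
          ≈⟨ *-congˡ (+-congʳ (+-congˡ (*-congˡ (sym (cancelˡ _ cc⁻¹≈1))))) ⟩
        β * (u * ((c⁻¹ * (p * Z)) * (c⁻¹ * (p * Z))) + 2# * (c * (c⁻¹ * (p * Z * (c⁻¹ * (u * W))))) + p * ((c⁻¹ * (u * W)) * (c⁻¹ * (u * W))))
          ≈⟨ solve 7 (λ β u p c c′ Z W →
               β :* (u :* ((c′ :* (p :* Z)) :* (c′ :* (p :* Z))) :+ con (+ 2) :* (c :* (c′ :* (p :* Z :* (c′ :* (u :* W)))))
                 :+ p :* ((c′ :* (u :* W)) :* (c′ :* (u :* W)))) :=
               β :* (u :* p) :* (c′ :* c′) :* (p :* (Z :* Z) :+ con (+ 2) :* (c :* (Z :* W)) :+ u :* (W :* W)))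
               refl β u p c c⁻¹ Z W ⟩
        β * (u * p) * (c⁻¹ * c⁻¹) * (p * (Z * Z) + 2# * (c * (Z * W)) + u * (W * W))
          ≈⟨ *-congʳ βupc⁻² ⟩
        2# * 2# * ρ * (p * (Z * Z) + 2# * (c * (Z * W)) + u * (W * W)) ∎
      4E : q (z + 2# * S) (w + 2# * T) - (1# - β) * q z w ≈ 2# * 2# * E S W T Z
      4E = begin
        q (z + 2# * S) (w + 2# * T) - (1# - β) * q z w
          ≈⟨ q-difference β S T z w ⟩
        2# * 2# * (u * (S * S) + 2# * (c * (S * T)) + p * (T * T)
          + (S * (u * z) + S * (c * w) + (T * (c * z) + T * (p * w)))) + β * q z w
          ≈⟨ +-cong (*-congˡ (+-congˡ (+-cong (+-cong (*-congˡ uz≈gZ) (*-congˡ cw≈uW)) (+-cong (*-congˡ cz≈pZ) (*-congˡ pw≈gW))))) βq≈ ⟩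
        2# * 2# * (u * (S * S) + 2# * (c * (S * T)) + p * (T * T)
          + (S * (g * Z) + S * (u * W) + (T * (p * Z) + T * (g * W))))
          + 2# * 2# * ρ * (p * (Z * Z) + 2# * (c * (Z * W)) + u * (W * W))
          ≈⟨ solve 9 (λ u c p ρ g S T Z W →
               let 2̂ = con (+ 2) ; N x y = x :* x :+ x :* y :+ ρ :* (y :* y) in
               2̂ :* 2̂ :* (u :* (S :* S) :+ 2̂ :* (c :* (S :* T)) :+ p :* (T :* T)
                 :+ (S :* (g :* Z) :+ S :* (u :* W) :+ (T :* (p :* Z) :+ T :* (g :* W))))
                 :+ 2̂ :* 2̂ :* ρ :* (p :* (Z :* Z) :+ 2̂ :* (c :* (Z :* W)) :+ u :* (W :* W)) :=
               2̂ :* 2̂ :* (u :* N S W :+ p :* N T Z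
                 :+ (2̂ :* c :* (S :* T) :+ g :* (S :* Z) :+ (g :* (W :* T) :+ 2̂ :* ρ :* c :* (W :* Z)))))
               refl u c p ρ g S T Z W ⟩
        2# * 2# * E S W T Z ∎

  dissimilar : ∃[ l ] Unit l × Dissimilar l
  dissimilar with 𝔪⊎v c∈𝒪
  ... | inj₁ c∈𝔪    = dissimilar-𝔪 c∈𝔪
  ... | inj₂ c-unit = dissimilar-unit c-unit

  -- Here u, c, p, a, b, d are the Gram entries of vectors x, y, w. If r₁x + r₂y + r₃w is orthogonal
  -- to all three, then r₁x + r₂y and -r₃w have the same norm.
  q-relation : ∀ l {r₁ r₂ r₃ s t a b d} →
    r₁ * u + r₂ * c + r₃ * a ≈ 0# → r₁ * c + r₂ * p + r₃ * b ≈ 0# → r₁ * a + r₂ * b + r₃ * d ≈ 0# → d ≈ l * q s t →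
    q r₁ r₂ ≈ l * q (r₃ * s) (r₃ * t)
  q-relation l {r₁} {r₂} {r₃} {s} {t} {a} {b} {d} ⊥x ⊥y ⊥w d≈lq = begin
    q r₁ r₂
      ≈⟨ solve 9 (λ r₁ r₂ r₃ u c p a b d →
           u :* (r₁ :* r₁) :+ con (+ 2) :* (c :* (r₁ :* r₂)) :+ p :* (r₂ :* r₂) :=
           r₁ :* (r₁ :* u :+ r₂ :* c :+ r₃ :* a) :+ r₂ :* (r₁ :* c :+ r₂ :* p :+ r₃ :* b)
             :- r₃ :* (r₁ :* a :+ r₂ :* b :+ r₃ :* d) :+ r₃ :* r₃ :* d) refl r₁ r₂ r₃ u c p a b d ⟩
    r₁ * (r₁ * u + r₂ * c + r₃ * a) + r₂ * (r₁ * c + r₂ * p + r₃ * b) - r₃ * (r₁ * a + r₂ * b + r₃ * d) + r₃ * r₃ * d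
      ≈⟨ +-cong (+-cong (+-cong (*-congˡ ⊥x) (*-congˡ ⊥y)) (-‿cong (*-congˡ ⊥w))) (*-congˡ d≈lq) ⟩
    r₁ * 0# + r₂ * 0# - r₃ * 0# + r₃ * r₃ * (l * q s t)
      ≈⟨ solve 4 (λ r₁ r₂ r₃ x → r₁ :* con (+ 0) :+ r₂ :* con (+ 0) :- r₃ :* con (+ 0) :+ x := x) refl r₁ r₂ r₃ _ ⟩
    r₃ * r₃ * (l * q s t)
      ≈⟨ solve 7 (λ r₃ l u c p s t →
           let q s t = u :* (s :* s) :+ con (+ 2) :* (c :* (s :* t)) :+ p :* (t :* t) in
           r₃ :* r₃ :* (l :* q s t) := l :* q (r₃ :* s) (r₃ :* t)) refl r₃ l u c p s t ⟩
    l * q (r₃ * s) (r₃ * t) ∎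

  -- A vanishing determinant would make (-c, u) a nontrivial zero, since q(-c,u) = u(up - c²).
  q-det : ∀ {l} → Dissimilar l → ¬ (u * p - c * c ≈ 0#)
  q-det {l} q-dissimilar det≈0 = finite≉0 u-unit (proj₂ (proj₁ (q-dissimilar {s = - c} {t = u} {z = 0#} {w = 0#} (begin
    q (- c) u
      ≈⟨ solve 3 (λ u c p → u :* (:- c :* :- c) :+ con (+ 2) :* (c :* (:- c :* u)) :+ p :* (u :* u) := u :* (u :* p :- c :* c)) refl u c p ⟩
    u * (u * p - c * c)
      ≈⟨ *-congˡ det≈0 ⟩
    u * 0#
      ≈⟨ solve 4 (λ u c p l → u :* con (+ 0) := l :* (u :* (con (+ 0) :* con (+ 0)) :+ con (+ 2) :* (c :* (con (+ 0) :* con (+ 0))) :+ p :* (con (+ 0) :* con (+ 0)))) refl u c p l ⟩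
    l * q 0# 0# ∎))))

-- Linear relations and exchange of finite sums

module SumExchange {c ℓ} (R : CommutativeRing c ℓ) where
  open CommutativeRing R hiding (zero)
  open SemiringSum semiring
  open SetoidReasoning setoid

  -- A relation between coordinate vectors passes to the combinations that they describe, once the
  -- order of summation is exchanged.
  relation-transport : ∀ {m n} (k : Vector Carrier m) (A : Fin m → Vector Carrier n) (b : Vector Carrier n) →
    (∀ j → sum (λ i → k i * A i j) ≈ 0#) → sum (λ i → k i * sum (λ j → A i j * b j)) ≈ 0#
  relation-transport {m} {n} k A b relation = begin
    sum (λ i → k i * sum (λ j → A i j * b j))
      ≈⟨ sum-cong-≋ (λ i → *-distribˡ-sum (k i) (λ j → A i j * b j)) ⟩
    sum (λ i → sum (λ j → k i * (A i j * b j)))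
      ≈⟨ ∑-comm (λ i j → k i * (A i j * b j)) ⟩
    sum (λ j → sum (λ i → k i * (A i j * b j)))
      ≈⟨ sum-cong-≋ (λ j → sum-cong-≋ (λ i → sym (*-assoc (k i) (A i j) (b j)))) ⟩
    sum (λ j → sum (λ i → k i * A i j * b j))
      ≈⟨ sum-cong-≋ (λ j → *-distribʳ-sum (b j) (λ i → k i * A i j)) ⟨
    sum (λ j → sum (λ i → k i * A i j) * b j)
      ≈⟨ sum-cong-≋ (λ j → trans (*-congʳ (relation j)) (zeroˡ (b j))) ⟩
    sum {n} (λ _ → 0#)
      ≈⟨ sum-replicate-zero n ⟩
    0# ∎


-- Quadratic spaces and lattices

module Geometry {c ℓ₁ ℓ₂ p k κ₁ κ₂} {F : NumberField c ℓ₁ ℓ₂} {𝔭 : DyadicPrime F p}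
  (F𝔭 : Completion F 𝔭 k κ₁ κ₂) where
  open Completion F𝔭 hiding (zero)
  open Valued heytingField v isDiscreteValuation
  open RingProperties ring
  open SetoidReasoning setoid

  -- The binary lattice with a given Gram matrix

  module Plane (a b c : Carrier) (det≉0 : ¬ (a * c - b * b ≈ 0#)) where
    K² : Module commutativeRing k κ₁
    K² = DirectProduct.⟨module⟩ (TensorUnit.⟨module⟩ {R = commutativeRing}) (TensorUnit.⟨module⟩ {R = commutativeRing})
    open Module K² using (Carrierᴹ; _≈ᴹ_)

    β : Carrierᴹ → Carrierᴹ → Carrier
    β (x₁ , x₂) (y₁ , y₂) = a * (x₁ * y₁) + b * (x₁ * y₂ + x₂ * y₁) + c * (x₂ * y₂)

    β-basis₁ : ∀ x₁ x₂ → β (x₁ , x₂) (1# , 0#) ≈ a * x₁ + b * x₂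
    β-basis₁ x₁ x₂ = solve 5 (λ a b c x₁ x₂ → a :* (x₁ :* con (+ 1)) :+ b :* (x₁ :* con (+ 0) :+ x₂ :* con (+ 1)) :+ c :* (x₂ :* con (+ 0))
      := a :* x₁ :+ b :* x₂) refl a b c x₁ x₂

    β-basis₂ : ∀ x₁ x₂ → β (x₁ , x₂) (0# , 1#) ≈ b * x₁ + c * x₂
    β-basis₂ x₁ x₂ = solve 5 (λ a b c x₁ x₂ → a :* (x₁ :* con (+ 0)) :+ b :* (x₁ :* con (+ 1) :+ x₂ :* con (+ 0)) :+ c :* (x₂ :* con (+ 1))
      := b :* x₁ :+ c :* x₂) refl a b c x₁ x₂

    -- Cramer's rule: combining the pairings with the two basis vectors isolates the determinant
    -- times each coordinate.
    nonDegenerate : ∀ x → (∀ y → β x y ≈ 0#) → x ≈ᴹ (0# , 0#)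
    nonDegenerate (x₁ , x₂) x⊥ = *-cancelˡ-0 det≉0 (begin
        (a * c - b * b) * x₁
          ≈⟨ solve 5 (λ a b c x₁ x₂ → (a :* c :- b :* b) :* x₁ := c :* (a :* x₁ :+ b :* x₂) :- b :* (b :* x₁ :+ c :* x₂)) refl a b c x₁ x₂ ⟩
        c * (a * x₁ + b * x₂) - b * (b * x₁ + c * x₂) ≈⟨ +-cong (*-congˡ r₁) (-‿cong (*-congˡ r₂)) ⟩
        c * 0# - b * 0# ≈⟨ solve 2 (λ b c → c :* con (+ 0) :- b :* con (+ 0) := con (+ 0)) refl b c ⟩
        0# ∎) , *-cancelˡ-0 det≉0 (begin
        (a * c - b * b) * x₂
          ≈⟨ solve 5 (λ a b c x₁ x₂ → (a :* c :- b :* b) :* x₂ := a :* (b :* x₁ :+ c :* x₂) :- b :* (a :* x₁ :+ b :* x₂)) refl a b c x₁ x₂ ⟩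
        a * (b * x₁ + c * x₂) - b * (a * x₁ + b * x₂) ≈⟨ +-cong (*-congˡ r₂) (-‿cong (*-congˡ r₁)) ⟩
        a * 0# - b * 0# ≈⟨ solve 2 (λ b c → c :* con (+ 0) :- b :* con (+ 0) := con (+ 0)) refl b a ⟩
        0# ∎)
      where
      r₁ : a * x₁ + b * x₂ ≈ 0#
      r₁ = trans (sym (β-basis₁ x₁ x₂)) (x⊥ (1# , 0#))
      r₂ : b * x₁ + c * x₂ ≈ 0#
      r₂ = trans (sym (β-basis₂ x₁ x₂)) (x⊥ (0# , 1#))

    e : Vector Carrierᴹ 2
    e = (1# , 0#) ∷ (0# , 1#) ∷ []

    first : ∀ s t → s * 1# + (t * 0# + 0#) ≈ s
    first = solve 2 (λ s t → s :* con (+ 1) :+ (t :* con (+ 0) :+ con (+ 0)) := s) refl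

    second : ∀ s t → s * 0# + (t * 1# + 0#) ≈ t
    second = solve 2 (λ s t → s :* con (+ 0) :+ (t :* con (+ 1) :+ con (+ 0)) := t) refl

    space : QuadraticSpace F𝔭
    space = record
      { vectorSpace   = K²
      ; dim           = 2
      ; basis         = e
      ; spanning      = λ { (x₁ , x₂) → (x₁ ∷ x₂ ∷ []) , (sym (first x₁ x₂) , sym (second x₁ x₂)) }
      ; independent   = λ { s (s₁≈0 , s₂≈0) 0F → trans (sym (first (s 0F) (s 1F))) s₁≈0
                          ; s (s₁≈0 , s₂≈0) 1F → trans (sym (second (s 0F) (s 1F))) s₂≈0 }
      ; B             = β
      ; B-cong        = λ { (x₁ , x₂) (y₁ , y₂) → +-cong (+-cong (*-congˡ (*-cong x₁ y₁))
                              (*-congˡ (+-cong (*-cong x₁ y₂) (*-cong x₂ y₁)))) (*-congˡ (*-cong x₂ y₂)) }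
      ; B-sym         = λ { (x₁ , x₂) (y₁ , y₂) → solve 7 (λ a b c x₁ x₂ y₁ y₂ →
                              a :* (x₁ :* y₁) :+ b :* (x₁ :* y₂ :+ x₂ :* y₁) :+ c :* (x₂ :* y₂) :=
                              a :* (y₁ :* x₁) :+ b :* (y₁ :* x₂ :+ y₂ :* x₁) :+ c :* (y₂ :* x₂)) refl a b c x₁ x₂ y₁ y₂ }
      ; B-+ˡ          = λ { (x₁ , x₂) (y₁ , y₂) (z₁ , z₂) → solve 9 (λ a b c x₁ x₂ y₁ y₂ z₁ z₂ →
                              let B x₁ x₂ z₁ z₂ = a :* (x₁ :* z₁) :+ b :* (x₁ :* z₂ :+ x₂ :* z₁) :+ c :* (x₂ :* z₂) in
                              B (x₁ :+ y₁) (x₂ :+ y₂) z₁ z₂ := B x₁ x₂ z₁ z₂ :+ B y₁ y₂ z₁ z₂) refl a b c x₁ x₂ y₁ y₂ z₁ z₂ }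
      ; B-*ˡ          = λ { s (x₁ , x₂) (z₁ , z₂) → solve 8 (λ a b c s x₁ x₂ z₁ z₂ →
                              let B x₁ x₂ z₁ z₂ = a :* (x₁ :* z₁) :+ b :* (x₁ :* z₂ :+ x₂ :* z₁) :+ c :* (x₂ :* z₂) in
                              B (s :* x₁) (s :* x₂) z₁ z₂ := s :* B x₁ x₂ z₁ z₂) refl a b c s x₁ x₂ z₁ z₂ }
      ; nonDegenerate = nonDegenerate
      }

    lattice : Lattice F𝔭
    lattice = record
      { space = space ; size = 2 ; generators = e ; spans = QuadraticSpace.spanning space }

    open Lattice lattice using (_∈L)

    ∈L⇒𝒪 : ∀ {x} → x ∈L → 𝒪 (proj₁ x) × 𝒪 (proj₂ x)
    ∈L⇒𝒪 (s , s∈ , (x₁ , x₂)) = ∈-resp (sym (trans x₁ (first (s 0F) (s 1F)))) (s∈ 0F)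
                              , ∈-resp (sym (trans x₂ (second (s 0F) (s 1F)))) (s∈ 1F)

    𝒪⇒∈L : ∀ {x₁ x₂} → 𝒪 x₁ → 𝒪 x₂ → (x₁ , x₂) ∈L
    𝒪⇒∈L {x₁} {x₂} x₁∈ x₂∈ = (x₁ ∷ x₂ ∷ []) , (λ { 0F → x₁∈ ; 1F → x₂∈ }) , (sym (first x₁ x₂) , sym (second x₁ x₂))

    classicIntegral : 𝒪 a → 𝒪 b → 𝒪 c → ClassicIntegral F𝔭 lattice
    classicIntegral a∈ b∈ c∈ {x} {y} x∈L y∈L =
      let x₁ , x₂ = ∈L⇒𝒪 {x} x∈L ; y₁ , y₂ = ∈L⇒𝒪 {y} y∈L in
      +-∈ (+-∈ (*-∈ 0 0 a∈ (*-∈ 0 0 x₁ y₁)) (*-∈ 0 0 b∈ (+-∈ (*-∈ 0 0 x₁ y₂) (*-∈ 0 0 x₂ y₁)))) (*-∈ 0 0 c∈ (*-∈ 0 0 x₂ y₂))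

  -- Polarisation and linear relations in a quadratic space

  module QuadraticSpaceProperties (V : QuadraticSpace F𝔭) where
    open QuadraticSpace V
    open SemiringSum semiring using (sum-cong-≋)

    B-+ʳ : ∀ x y z → B x (y +ᴹ z) ≈ B x y + B x z
    B-+ʳ x y z = trans (B-sym x (y +ᴹ z)) (trans (B-+ˡ y z x) (+-cong (B-sym y x) (B-sym z x)))

    B-*ʳ : ∀ a x y → B x (a *ₗ y) ≈ a * B x y
    B-*ʳ a x y = trans (B-sym x (a *ₗ y)) (trans (B-*ˡ a y x) (*-congˡ (B-sym y x)))

    B-0ˡ : ∀ x → B 0ᴹ x ≈ 0#
    B-0ˡ x = trans (B-cong (≈ᴹ-sym (*ₗ-zeroˡ 0ᴹ)) ≈ᴹ-refl) (trans (B-*ˡ 0# 0ᴹ x) (zeroˡ _))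

    B-combination : ∀ {n} (a : Vector Carrier n) e y → B (combination a e) y ≈ sum (λ i → a i * B (e i) y)
    B-combination {zero}  a e y = B-0ˡ y
    B-combination {suc n} a e y = trans (B-+ˡ _ _ y) (+-cong (B-*ˡ _ _ y) (B-combination (tail a) (tail e) y))

    Q-+ : ∀ x y → Q (x +ᴹ y) ≈ Q x + 2# * B x y + Q y
    Q-+ x y = begin
      B (x +ᴹ y) (x +ᴹ y)                   ≈⟨ B-+ˡ x y (x +ᴹ y) ⟩
      B x (x +ᴹ y) + B y (x +ᴹ y)           ≈⟨ +-cong (B-+ʳ x x y) (B-+ʳ y x y) ⟩
      B x x + B x y + (B y x + B y y)       ≈⟨ +-congˡ (+-congʳ (B-sym y x)) ⟩
      B x x + B x y + (B x y + B y y)       ≈⟨ solve 3 (λ a b c → a :+ b :+ (b :+ c) := a :+ con (+ 2) :* b :+ c) refl (B x x) (B x y) (B y y) ⟩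
      Q x + 2# * B x y + Q y                ∎

    Q-combination : ∀ s t x y → Q (s *ₗ x +ᴹ t *ₗ y) ≈ s * s * Q x + 2# * (s * t * B x y) + t * t * Q y
    Q-combination s t x y = begin
      Q (s *ₗ x +ᴹ t *ₗ y)
        ≈⟨ Q-+ (s *ₗ x) (t *ₗ y) ⟩
      Q (s *ₗ x) + 2# * B (s *ₗ x) (t *ₗ y) + Q (t *ₗ y)
        ≈⟨ +-cong (+-cong (B-*ₗ s s x x) (*-congˡ (B-*ₗ s t x y))) (B-*ₗ t t y y) ⟩
      s * s * Q x + 2# * (s * t * B x y) + t * t * Q y ∎
      where
      B-*ₗ : ∀ s t x y → B (s *ₗ x) (t *ₗ y) ≈ s * t * B x y
      B-*ₗ s t x y = trans (B-*ˡ s x (t *ₗ y)) (trans (*-congˡ (B-*ʳ t x y)) (sym (*-assoc s t (B x y))))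

    -- Coordinate vectors of n + 1 vectors in dimension n are dependent. The relation is recorded
    -- through its pairings, the only form in which it is used.
    gram-dependence : ∀ {n} → dim ≡ n → (w : Vector Carrierᴹ (suc n)) →
      Σ[ r ∈ Vector Carrier (suc n) ] (∃[ i ] ¬ (r i ≈ 0#)) × (∀ y → sum (λ i → r i * B (w i) y) ≈ 0#)
    gram-dependence ≡.refl w = r , nonzero , λ y → begin
        sum (λ i → r i * B (w i) y)
          ≈⟨ sum-cong-≋ (λ i → *-congˡ {x = r i} (trans (B-cong (proj₂ (spanning (w i))) ≈ᴹ-refl) (B-combination (A i) basis y))) ⟩
        sum (λ i → r i * sum (λ j → A i j * B (basis j) y))
          ≈⟨ SumExchange.relation-transport commutativeRing r A (λ j → B (basis j) y) relation ⟩
        0# ∎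
      where
      A : Fin (suc dim) → Vector Carrier dim
      A i = proj₁ (spanning (w i))
      open LinearDependence commutativeRing _≈0? 1≉0 *-cancelˡ-0
      r = proj₁ (dependence A)
      nonzero = proj₁ (proj₂ (dependence A))
      relation = proj₂ (proj₂ (dependence A))

    -- Among e, f, x, y, w there is a relation. Pairing it with f and with e kills the coefficients
    -- of e and f, so it is a relation between x, y and w alone.
    perp-dependence : dim ≡ 4 → ∀ {e f} → Q e ≈ 0# → B e f ≈ 1# → Q f ≈ 0# → ∀ {x y w} →
      B x e ≈ 0# → B x f ≈ 0# → B y e ≈ 0# → B y f ≈ 0# → B w e ≈ 0# → B w f ≈ 0# →
      ∃[ r₁ ] ∃[ r₂ ] ∃[ r₃ ] ¬ (r₁ ≈ 0# × r₂ ≈ 0# × r₃ ≈ 0#) ×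
        (∀ z → B z e ≈ 0# → B z f ≈ 0# → r₁ * B x z + r₂ * B y z + r₃ * B w z ≈ 0#)
    perp-dependence dim≡4 {e} {f} Qe≈0 Bef≈1 Qf≈0 {x} {y} {w} x⊥e x⊥f y⊥e y⊥f w⊥e w⊥f =
      let r , (i , ri≉0) , relation = gram-dependence dim≡4 (e ∷ f ∷ x ∷ y ∷ w ∷ [])
          r₀≈0 , r₁≈0 , perp = eliminate (r 0F) (r 1F) (r 2F) (r 3F) (r 4F) relation
      in r 2F , r 3F , r 4F , (λ (r₂≈0 , r₃≈0 , r₄≈0) → ri≉0 (all≈0 r r₀≈0 r₁≈0 r₂≈0 r₃≈0 r₄≈0 i)) , perp
      where
      all≈0 : ∀ (r : Vector Carrier 5) → r 0F ≈ 0# → r 1F ≈ 0# → r 2F ≈ 0# → r 3F ≈ 0# → r 4F ≈ 0# → ∀ i → r i ≈ 0#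
      all≈0 r r₀ r₁ r₂ r₃ r₄ 0F = r₀
      all≈0 r r₀ r₁ r₂ r₃ r₄ 1F = r₁
      all≈0 r r₀ r₁ r₂ r₃ r₄ 2F = r₂
      all≈0 r r₀ r₁ r₂ r₃ r₄ 3F = r₃
      all≈0 r r₀ r₁ r₂ r₃ r₄ 4F = r₄
      eliminate : ∀ r₀ r₁ r₂ r₃ r₄ →
        (∀ z → r₀ * B e z + (r₁ * B f z + (r₂ * B x z + (r₃ * B y z + (r₄ * B w z + 0#)))) ≈ 0#) →
        r₀ ≈ 0# × r₁ ≈ 0# × (∀ z → B z e ≈ 0# → B z f ≈ 0# → r₂ * B x z + r₃ * B y z + r₄ * B w z ≈ 0#)
      eliminate r₀ r₁ r₂ r₃ r₄ relation =
          trans (solve 5 (λ r₀ r₁ r₂ r₃ r₄ → r₀ := r₀ :* con (+ 1) :+ (r₁ :* con (+ 0) :+ (r₂ :* con (+ 0) :+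
            (r₃ :* con (+ 0) :+ (r₄ :* con (+ 0) :+ con (+ 0)))))) refl r₀ r₁ r₂ r₃ r₄)
            (at f Bef≈1 Qf≈0 x⊥f y⊥f w⊥f)
        , trans (solve 5 (λ r₀ r₁ r₂ r₃ r₄ → r₁ := r₀ :* con (+ 0) :+ (r₁ :* con (+ 1) :+ (r₂ :* con (+ 0) :+
            (r₃ :* con (+ 0) :+ (r₄ :* con (+ 0) :+ con (+ 0)))))) refl r₀ r₁ r₂ r₃ r₄)
            (at e Qe≈0 (trans (B-sym f e) Bef≈1) x⊥e y⊥e w⊥e)
        , λ z z⊥e z⊥f → trans
            (solve 8 (λ r₀ r₁ r₂ r₃ r₄ c d g → r₂ :* c :+ r₃ :* d :+ r₄ :* g := r₀ :* con (+ 0) :+ (r₁ :* con (+ 0) :+ (r₂ :* c :+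
              (r₃ :* d :+ (r₄ :* g :+ con (+ 0)))))) refl r₀ r₁ r₂ r₃ r₄ (B x z) (B y z) (B w z))
            (at z (trans (B-sym e z) z⊥e) (trans (B-sym f z) z⊥f) refl refl refl)
        where
        at : ∀ z {a b c d g} → B e z ≈ a → B f z ≈ b → B x z ≈ c → B y z ≈ d → B w z ≈ g →
          r₀ * a + (r₁ * b + (r₂ * c + (r₃ * d + (r₄ * g + 0#)))) ≈ 0#
        at z a b c d g = trans (sym (+-cong (*-congˡ a) (+-cong (*-congˡ b) (+-cong (*-congˡ c)
          (+-cong (*-congˡ d) (+-congʳ (*-congˡ g))))))) (relation z)

  module LatticeProperties (M : Lattice F𝔭) where
    open Lattice M
    open CommutativeMonoidSum +ᴹ-commutativeMonoid using () renaming (∑-distrib-+ to ∑ᴹ-distrib-+; sum-cong-≋ to sumᴹ-cong)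

    *ₗ-distribˡ-sumᴹ : ∀ {n} s (x : Vector Carrierᴹ n) → s *ₗ sumᴹ x ≈ᴹ sumᴹ (λ i → s *ₗ x i)
    *ₗ-distribˡ-sumᴹ {zero}  s x = *ₗ-zeroʳ s
    *ₗ-distribˡ-sumᴹ {suc n} s x = ≈ᴹ-trans (*ₗ-distribˡ s _ _) (+ᴹ-congˡ (*ₗ-distribˡ-sumᴹ s (tail x)))

    +ᴹ-closed : ∀ {x y} → x ∈L → y ∈L → (x +ᴹ y) ∈L
    +ᴹ-closed (a , a∈ , x≈) (b , b∈ , y≈) = (λ i → a i + b i) , (λ i → +-∈ (a∈ i) (b∈ i)) ,
      ≈ᴹ-trans (+ᴹ-cong x≈ y≈) (≈ᴹ-trans (≈ᴹ-sym (∑ᴹ-distrib-+ (λ i → a i *ₗ generators i) (λ i → b i *ₗ generators i)))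
        (sumᴹ-cong (λ i → ≈ᴹ-sym (*ₗ-distribʳ (generators i) (a i) (b i)))))

    *ₗ-closed : ∀ {s x} → 𝒪 s → x ∈L → (s *ₗ x) ∈L
    *ₗ-closed {s} s∈ (a , a∈ , x≈) = (λ i → s * a i) , (λ i → *-∈ 0 0 s∈ (a∈ i)) ,
      ≈ᴹ-trans (*ₗ-cong refl x≈) (≈ᴹ-trans (*ₗ-distribˡ-sumᴹ s (λ i → a i *ₗ generators i)) (sumᴹ-cong (λ i → ≈ᴹ-sym (*ₗ-assoc s (a i) (generators i)))))

  record HasGram (M : Lattice F𝔭) (a b c : Carrier) : Set (k ⊔ κ₁) where
    open Lattice M
    field
      {x y} : Carrierᴹ
      x∈ : x ∈L
      y∈ : y ∈L
      Qx : Q x ≈ a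
      Bxy : B x y ≈ b
      Qy : Q y ≈ c

  -- A representation is only required to preserve Q. The mixed entry is recovered from the norm of
  -- the sum of the two images, after cancelling 2.
  represents-gram : ¬ (2# ≈ 0#) → ∀ {M} → ClassicUniversal F𝔭 2 M → ∀ {a b c} → ¬ (a * c - b * b ≈ 0#) →
    𝒪 a → 𝒪 b → 𝒪 c → HasGram M a b c
  represents-gram 2≉0 {M} (_ , universal) {a} {b} {c} det≉0 a∈ b∈ c∈ = record
    { x∈  = σ-L⊆M (𝒪⇒∈L 1∈𝒪 0∈)
    ; y∈  = σ-L⊆M (𝒪⇒∈L 0∈ 1∈𝒪)
    ; Qx  = Qx
    ; Qy  = Qy
    ; Bxy = x∙y⁻¹≈ε⇒x≈y _ _ (*-cancelˡ-0 2≉0 (begin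
        2# * (M.B f g - b)
          ≈⟨ solve 4 (λ x y B b → con (+ 2) :* (B :- b) := (x :+ con (+ 2) :* B :+ y) :- (x :+ con (+ 2) :* b :+ y)) refl
               (M.Q f) (M.Q g) (M.B f g) b ⟩
        (M.Q f + 2# * M.B f g + M.Q g) - (M.Q f + 2# * b + M.Q g)
          ≈⟨ +-cong (trans (sym (Q-+ f g)) (trans (M.B-cong (M.≈ᴹ-sym (+ᴹ-homo x₁ x₂)) (M.≈ᴹ-sym (+ᴹ-homo x₁ x₂))) (σ-isometric (1# + 0# , 0# + 1#))))
               (-‿cong (+-cong (+-congʳ Qx) Qy)) ⟩
        β (1# + 0# , 0# + 1#) (1# + 0# , 0# + 1#) - (a + 2# * b + c)
          ≈⟨ solve 3 (λ a b c → let i = con (+ 1) :+ con (+ 0) ; j = con (+ 0) :+ con (+ 1) in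
               (a :* (i :* i) :+ b :* (i :* j :+ j :* i) :+ c :* (j :* j)) :- (a :+ con (+ 2) :* b :+ c) := con (+ 0)) refl a b c ⟩
        0# ∎))
    }
    where
    module M = Lattice M
    open Plane a b c det≉0
    open _IsRepresentedBy_ (universal lattice ≡.refl (λ {x} {y} → classicIntegral a∈ b∈ c∈ {x} {y}))
    open ModuleMorphisms.IsModuleHomomorphism σ-linear using (+ᴹ-homo)
    open QuadraticSpaceProperties M.space
    x₁ x₂ : Carrier × Carrier
    x₁ = 1# , 0#
    x₂ = 0# , 1#
    f = σ x₁
    g = σ x₂
    Qx : M.Q f ≈ a
    Qx = trans (σ-isometric x₁) (trans (β-basis₁ 1# 0#) (solve 2 (λ a b → a :* con (+ 1) :+ b :* con (+ 0) := a) refl a b))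
    Qy : M.Q g ≈ c
    Qy = trans (σ-isometric x₂) (trans (β-basis₂ 0# 1#) (solve 2 (λ b c → b :* con (+ 0) :+ c :* con (+ 1) := c) refl b c))

  -- Refutation of a classic 2-universal lattice of rank four

  module Contradiction (2∈𝔪 : 𝔪 2#) (2≉0 : ¬ (2# ≈ 0#))
    (ρ : Carrier) (ρ∈𝒪 : 𝒪 ρ) (irreducible : Irreducible ρ)
    (M : Lattice F𝔭) (rank≡4 : Lattice.rank M ≡ 4) (universal : ClassicUniversal F𝔭 2 M) where
    open Lattice M
    open LatticeProperties M
    open QuadraticSpaceProperties space

    integral : ∀ {x y} → x ∈L → y ∈L → 𝒪 (B x y)
    integral = proj₁ universal

    hyperbolic : HasGram M 0# 1# 0#
    hyperbolic = represents-gram 2≉0 universal det≉0 0∈ 1∈𝒪 0∈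
      where
      det≉0 : ¬ (0# * 0# - 1# * 1# ≈ 0#)
      det≉0 det≈0 = 1≉0 (trans (solve 0 (con (+ 1) := :- (con (+ 0) :* con (+ 0) :- con (+ 1) :* con (+ 1))) refl)
        (trans (-‿cong det≈0) -0#≈0#))

    open HasGram hyperbolic using () renaming (x to e; y to f; x∈ to e∈; y∈ to f∈; Qx to Qe≈0; Bxy to Bef≈1; Qy to Qf≈0)

    -- The orthogonal projection along the hyperbolic plane. As e and f are isotropic with B(e,f) =
    -- 1, the coefficient of e is the pairing with f and vice versa.
    proj : Carrierᴹ → Carrierᴹ
    proj m = m +ᴹ ((- B m f) *ₗ e +ᴹ (- B m e) *ₗ f)

    proj-∈ : ∀ {m} → m ∈L → proj m ∈L
    proj-∈ m∈ = +ᴹ-closed m∈ (+ᴹ-closed (*ₗ-closed (-‿∈ (integral m∈ f∈)) e∈) (*ₗ-closed (-‿∈ (integral m∈ e∈)) f∈))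

    B-proj : ∀ m y → B (proj m) y ≈ B m y + (- B m f * B e y + - B m e * B f y)
    B-proj m y = trans (B-+ˡ _ _ y) (+-congˡ (trans (B-+ˡ _ _ y) (+-cong (B-*ˡ _ e y) (B-*ˡ _ f y))))

    proj-⊥e : ∀ m → B (proj m) e ≈ 0#
    proj-⊥e m = begin
      B (proj m) e                                         ≈⟨ B-proj m e ⟩
      B m e + (- B m f * B e e + - B m e * B f e)          ≈⟨ +-congˡ (+-cong (*-congˡ Qe≈0) (*-congˡ (trans (B-sym f e) Bef≈1))) ⟩
      B m e + (- B m f * 0# + - B m e * 1#)                ≈⟨ solve 2 (λ a b → a :+ (:- b :* con (+ 0) :+ :- a :* con (+ 1)) := con (+ 0)) refl (B m e) (B m f) ⟩
      0#                                                   ∎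

    proj-⊥f : ∀ m → B (proj m) f ≈ 0#
    proj-⊥f m = begin
      B (proj m) f                                         ≈⟨ B-proj m f ⟩
      B m f + (- B m f * B e f + - B m e * B f f)          ≈⟨ +-congˡ (+-cong (*-congˡ Bef≈1) (*-congˡ Qf≈0)) ⟩
      B m f + (- B m f * 1# + - B m e * 0#)                ≈⟨ solve 2 (λ a b → b :+ (:- b :* con (+ 1) :+ :- a :* con (+ 0)) := con (+ 0)) refl (B m e) (B m f) ⟩
      0#                                                   ∎

    Q-proj : ∀ m → Q (proj m) ≈ Q m - 2# * (B m e * B m f)
    Q-proj m = begin
      B (proj m) (proj m)
        ≈⟨ B-proj m (proj m) ⟩
      B m (proj m) + (- B m f * B e (proj m) + - B m e * B f (proj m))
        ≈⟨ +-cong (trans (B-sym m (proj m)) (B-proj m m))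
             (+-cong (*-congˡ (trans (B-sym e _) (proj-⊥e m))) (*-congˡ (trans (B-sym f _) (proj-⊥f m)))) ⟩
      B m m + (- B m f * B e m + - B m e * B f m) + (- B m f * 0# + - B m e * 0#)
        ≈⟨ +-congʳ (+-congˡ (+-cong (*-congˡ (B-sym e m)) (*-congˡ (B-sym f m)))) ⟩
      B m m + (- B m f * B m e + - B m e * B m f) + (- B m f * 0# + - B m e * 0#)
        ≈⟨ solve 3 (λ q a b → q :+ (:- b :* a :+ :- a :* b) :+ (:- b :* con (+ 0) :+ :- a :* con (+ 0)) := q :- con (+ 2) :* (a :* b)) refl
             (B m m) (B m e) (B m f) ⟩
      Q m - 2# * (B m e * B m f) ∎

    -- The hyperbolic component of such a vector is a multiple of the isotropic vector e, so
    -- removing it does not affect the norm.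
    Q-proj-⊥e : ∀ m → B m e ≈ 0# → Q (proj m) ≈ Q m
    Q-proj-⊥e m m⊥e = trans (Q-proj m) (trans (+-congˡ (-‿cong (*-congˡ (*-congʳ m⊥e))))
      (solve 2 (λ q b → q :- con (+ 2) :* (con (+ 0) :* b) := q) refl (Q m) (B m f)))

    2BB∈ : ∀ {m n} → 2# ∈𝔪^ n → m ∈L → (2# * (B m e * B m f)) ∈𝔪^ n
    2BB∈ {m} {n} 2∈ m∈ = ≡.subst ((2# * (B m e * B m f)) ∈𝔪^_) (ℕ.+-identityʳ n)
      (*-∈ n 0 2∈ (*-∈ 0 0 (integral m∈ e∈) (integral m∈ f∈)))

    π = proj₁ (IsDiscreteValuation.surjective isDiscreteValuation (+ 1))
    π-uniformizer : Uniformizer π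
    π-uniformizer = proj₂ (IsDiscreteValuation.surjective isDiscreteValuation (+ 1))

    diagonal : HasGram M 1# 0# π
    diagonal = represents-gram 2≉0 universal det≉0 1∈𝒪 0∈ (𝔪⇒𝒪 (uniformizer⇒𝔪 π-uniformizer))
      where
      det≉0 : ¬ (1# * π - 0# * 0# ≈ 0#)
      det≉0 det≈0 = finite≉0 π-uniformizer
        (trans (solve 1 (λ π → π := con (+ 1) :* π :- con (+ 0) :* con (+ 0)) refl π) det≈0)

    module D = HasGram diagonal

    x : Carrierᴹ
    x = proj D.x

    x-unit : Unit (Q x)
    x-unit = unit-cong (sym (trans (Q-proj D.x) (+-congʳ D.Qx))) (1-𝔪-unit (2BB∈ 2∈𝔪 D.x∈))

    record Orthogonal : Set (k ⊔ κ₁) where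
      field
        {y} : Carrierᴹ
        y∈  : y ∈L
        y⊥e : B y e ≈ 0#
        y⊥f : B y f ≈ 0#
        y-uniformizer : Uniformizer (Q y)

    -- The projection changes the norm π by an element of 𝔪² only, which keeps its value equal to 1.
    orthogonal-2∈𝔪² : 2# ∈𝔪^ 2 → Orthogonal
    orthogonal-2∈𝔪² 2∈𝔪² = record
      { y∈ = proj-∈ D.y∈ ; y⊥e = proj-⊥e D.y ; y⊥f = proj-⊥f D.y
      ; y-uniformizer = ∈∖∈⇒v
          (∈-resp (sym Q≈) (-∈ (uniformizer⇒𝔪 π-uniformizer) (2BB∈ 2∈𝔪 D.y∈)))
          (λ Q∈ → uniformizer∉𝔪² π-uniformizer (∈-resp
            (solve 2 (λ π b → π :- b :+ b := π) refl π (2# * (B D.y e * B D.y f)))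
            (+-∈ (∈-resp Q≈ Q∈) (2BB∈ 2∈𝔪² D.y∈)))) }
      where
      Q≈ : Q (proj D.y) ≈ π - 2# * (B D.y e * B D.y f)
      Q≈ = trans (Q-proj D.y) (+-congʳ D.Qy)

    open ArtinSchreier heytingField v isDiscreteValuation ρ ρ∈𝒪 irreducible using (N; N-∈; N-anisotropic)

    N-primitive : ∀ {s t} → Primitive s t → Unit (N s t)
    N-primitive {s} {t} ((s∈ , t∈) , one) with 𝔪⊎v (N-∈ s∈ t∈)
    ... | inj₂ N-unit = N-unit
    ... | inj₁ N∈ with N-anisotropic s∈ t∈ N∈ | one
    ...   | s∈𝔪 , _ | inj₁ s≈1 = contradiction (∈-resp s≈1 s∈𝔪) (unit∉𝔪 1-unit)
    ...   | _ , t∈𝔪 | inj₂ t≈1 = contradiction (∈-resp t≈1 t∈𝔪) (unit∉𝔪 1-unit)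

    -- Now the error of the projection may itself be a uniformizer, so a vector orthogonal to e is
    -- used, for which there is none. In the lattice 2N its norm is 2 times the unit N(s,t), by
    -- primitivity.
    orthogonal-2-uniformizer : Uniformizer 2# → Orthogonal
    orthogonal-2-uniformizer 2-uniformizer = record
      { y∈ = proj-∈ (+ᴹ-closed (*ₗ-closed s∈ U.x∈) (*ₗ-closed t∈ U.y∈)) ; y⊥e = proj-⊥e g ; y⊥f = proj-⊥f g
      ; y-uniformizer = ≡.trans (v-cong Qy≈2N) (*-unit-uniformizer (N-primitive prim) 2-uniformizer) }
      where
      open IsDiscreteValuation isDiscreteValuation using (v-cong)
      unramified : HasGram M 2# 1# (2# * ρ)
      unramified = represents-gram 2≉0 universal det≉0 (𝔪⇒𝒪 2∈𝔪) 1∈𝒪 (*-∈ 0 0 (𝔪⇒𝒪 2∈𝔪) ρ∈𝒪)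
        where
        det≉0 : ¬ (2# * (2# * ρ) - 1# * 1# ≈ 0#)
        det≉0 det≈0 = unit∉𝔪 1-unit (∈-resp (trans (x∙y⁻¹≈ε⇒x≈y _ _ det≈0) (*-identityˡ 1#))
          (*-∈ 1 0 2∈𝔪 (*-∈ 0 0 (𝔪⇒𝒪 2∈𝔪) ρ∈𝒪)))
      module U = HasGram unramified
      kernel = primitive-kernel (B U.x e) (B U.y e)
      s = proj₁ kernel
      t = proj₁ (proj₂ kernel)
      prim = proj₁ (proj₂ (proj₂ kernel))
      s∈ = proj₁ (proj₁ prim)
      t∈ = proj₂ (proj₁ prim)
      g = s *ₗ U.x +ᴹ t *ₗ U.y
      g⊥e : B g e ≈ 0#
      g⊥e = trans (B-+ˡ _ _ e) (trans (+-cong (B-*ˡ s U.x e) (B-*ˡ t U.y e)) (proj₂ (proj₂ (proj₂ kernel))))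
      Qy≈2N : Q (proj g) ≈ 2# * N s t
      Qy≈2N = begin
        Q (proj g) ≈⟨ Q-proj-⊥e g g⊥e ⟩
        Q g        ≈⟨ Q-combination s t U.x U.y ⟩
        s * s * Q U.x + 2# * (s * t * B U.x U.y) + t * t * Q U.y
          ≈⟨ +-cong (+-cong (*-congˡ U.Qx) (*-congˡ (*-congˡ U.Bxy))) (*-congˡ U.Qy) ⟩
        s * s * 2# + 2# * (s * t * 1#) + t * t * (2# * ρ)
          ≈⟨ solve 3 (λ s t ρ → s :* s :* con (+ 2) :+ con (+ 2) :* (s :* t :* con (+ 1)) :+ t :* t :* (con (+ 2) :* ρ)
               := con (+ 2) :* (s :* s :+ s :* t :+ ρ :* (t :* t))) refl s t ρ ⟩
        2# * N s t ∎

    orthogonal : Orthogonal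
    orthogonal with 𝔪⊎v 2∈𝔪
    ... | inj₁ 2∈𝔪²           = orthogonal-2∈𝔪² 2∈𝔪²
    ... | inj₂ 2-uniformizer = orthogonal-2-uniformizer 2-uniformizer

    module Conclusion {x y} (x∈ : x ∈L) (y∈ : y ∈L) (x⊥e : B x e ≈ 0#) (x⊥f : B x f ≈ 0#) (y⊥e : B y e ≈ 0#) (y⊥f : B y f ≈ 0#)
      (x-unit : Unit (Q x)) (y-uniformizer : Uniformizer (Q y)) where
      open BinarySimilarity heytingField v isDiscreteValuation 2∈𝔪 2≉0 ρ ρ∈𝒪 irreducible
        x-unit y-uniformizer (integral x∈ y∈)

      -- The scaled plane is non-degenerate because its determinant is l²(up - c²), which is nonzero
      -- by `q-det`.
      represents-scaled : ∀ {l} → Unit l → Dissimilar l → HasGram M (l * Q x) (l * B x y) (l * Q y)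
      represents-scaled {l} l-unit q-dissimilar = represents-gram 2≉0 universal det≉0 (*-∈ 0 0 l∈ (unit⇒𝒪 x-unit))
          (*-∈ 0 0 l∈ (integral x∈ y∈)) (*-∈ 0 0 l∈ (𝔪⇒𝒪 (uniformizer⇒𝔪 y-uniformizer)))
        where
        l∈ = unit⇒𝒪 l-unit
        det≉0 : ¬ (l * Q x * (l * Q y) - l * B x y * (l * B x y) ≈ 0#)
        det≉0 det≈0 = q-det {l} q-dissimilar (*-cancelˡ-0 (*-≉0 (finite≉0 l-unit) (finite≉0 l-unit)) (trans
          (solve 4 (λ u c p l → l :* l :* (u :* p :- c :* c) := l :* u :* (l :* p) :- l :* c :* (l :* c)) refl (Q x) (B x y) (Q y) l) det≈0))

      Q-scaled : ∀ {l s t x′ y′} → Q x′ ≈ l * Q x → B x′ y′ ≈ l * B x y → Q y′ ≈ l * Q y → Q (s *ₗ x′ +ᴹ t *ₗ y′) ≈ l * q s t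
      Q-scaled {l} {s} {t} {x′} {y′} Qx′ Bx′y′ Qy′ = begin
        Q (s *ₗ x′ +ᴹ t *ₗ y′) ≈⟨ Q-combination s t x′ y′ ⟩
        s * s * Q x′ + 2# * (s * t * B x′ y′) + t * t * Q y′
          ≈⟨ +-cong (+-cong (*-congˡ Qx′) (*-congˡ (*-congˡ Bx′y′))) (*-congˡ Qy′) ⟩
        s * s * (l * Q x) + 2# * (s * t * (l * B x y)) + t * t * (l * Q y)
          ≈⟨ solve 6 (λ s t l u c p → s :* s :* (l :* u) :+ con (+ 2) :* (s :* t :* (l :* c)) :+ t :* t :* (l :* p)
               := l :* (u :* (s :* s) :+ con (+ 2) :* (c :* (s :* t)) :+ p :* (t :* t))) refl s t l (Q x) (B x y) (Q y) ⟩
        l * q s t ∎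

      -- The complement of ⟨e,f⟩ has no room for x, y and w. Their relation gives q(r₁,r₂) =
      -- lq(r₃s,r₃t), hence r₁, r₂, r₃s and r₃t vanish, and with them r₃ since s or t is 1.
      dependent⇒⊥ : ∀ {l s t w} → Dissimilar l → Primitive s t → B w e ≈ 0# → B w f ≈ 0# → Q w ≈ l * q s t → ⊥
      dependent⇒⊥ {l} {s} {t} {w} q-dissimilar prim w⊥e w⊥f Qw≈lq =
        let _ , _ , _ , nonzero , relation = perp-dependence rank≡4 Qe≈0 Bef≈1 Qf≈0 x⊥e x⊥f y⊥e y⊥f w⊥e w⊥f
        in nonzero⇒⊥ nonzero relation
        where
        nonzero⇒⊥ : ∀ {r₁ r₂ r₃} → ¬ (r₁ ≈ 0# × r₂ ≈ 0# × r₃ ≈ 0#) →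
          ¬ (∀ z → B z e ≈ 0# → B z f ≈ 0# → r₁ * B x z + r₂ * B y z + r₃ * B w z ≈ 0#)
        nonzero⇒⊥ {r₁} {r₂} {r₃} nonzero relation = nonzero (proj₁ (proj₁ zeros) , proj₂ (proj₁ zeros) , r₃≈0 (proj₂ prim))
          where
          zeros : (r₁ ≈ 0# × r₂ ≈ 0#) × (r₃ * s ≈ 0# × r₃ * t ≈ 0#)
          zeros = q-dissimilar (q-relation l {r₁} {r₂} {r₃} {s} {t} {B x w} {B y w} {Q w}
            (trans (+-cong (+-congˡ (*-congˡ (B-sym x y))) (*-congˡ (B-sym x w))) (relation x x⊥e x⊥f))
            (trans (+-congˡ (*-congˡ (B-sym y w))) (relation y y⊥e y⊥f))
            (relation w w⊥e w⊥f) Qw≈lq)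
          r₃≈0 : s ≈ 1# ⊎ t ≈ 1# → r₃ ≈ 0#
          r₃≈0 (inj₁ s≈1) = trans (sym (trans (*-congˡ s≈1) (*-identityʳ r₃))) (proj₁ (proj₂ zeros))
          r₃≈0 (inj₂ t≈1) = trans (sym (trans (*-congˡ t≈1) (*-identityʳ r₃))) (proj₂ (proj₂ zeros))

      scaled⇒⊥ : ∀ {l} → Dissimilar l → ¬ HasGram M (l * Q x) (l * B x y) (l * Q y)
      scaled⇒⊥ {l} q-dissimilar scaled =
        let _ , _ , prim , kernel = primitive-kernel (B U.x e) (B U.y e) in primitive⇒⊥ prim kernel
        where
        module U = HasGram scaled
        primitive⇒⊥ : ∀ {s t} → Primitive s t → ¬ (s * B U.x e + t * B U.y e ≈ 0#)
        primitive⇒⊥ {s} {t} prim kernel =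
          dependent⇒⊥ {l} {s} {t} {proj g} q-dissimilar prim (proj-⊥e g) (proj-⊥f g)
            (trans (Q-proj-⊥e g g⊥e) (Q-scaled {l} {s} {t} U.Qx U.Bxy U.Qy))
          where
          g = s *ₗ U.x +ᴹ t *ₗ U.y
          g⊥e : B g e ≈ 0#
          g⊥e = trans (B-+ˡ _ _ e) (trans (+-cong (B-*ˡ s U.x e) (B-*ˡ t U.y e)) kernel)

      conclusion : ⊥
      conclusion = let _ , l-unit , q-dissimilar = dissimilar in
        dissimilar⇒⊥ l-unit q-dissimilar
        where
        dissimilar⇒⊥ : ∀ {l} → Unit l → ¬ Dissimilar l
        dissimilar⇒⊥ {l} l-unit q-dissimilar = scaled⇒⊥ {l} q-dissimilar (represents-scaled {l} l-unit q-dissimilar)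

    open Orthogonal orthogonal

    absurd : ⊥
    absurd = Conclusion.conclusion (proj-∈ D.x∈) y∈ (proj-⊥e D.x) (proj-⊥f D.x) y⊥e y⊥f x-unit y-uniformizer

-- The residue field

-- The operation `ℚ./` reduces fractions, so the claim is checked on unnormalised rationals, where
-- it is an identity of integers.
suc/1 : ∀ n → + suc n ℚ./ 1 ≡ 1ℚ ℚ.+ + n ℚ./ 1
suc/1 n = ℚ.toℚᵘ-injective (begin
  toℚᵘ (+ suc n ℚ./ 1)               ≈⟨ ℚ.toℚᵘ-fromℚᵘ (mkℚᵘ (+ suc n) 0) ⟩
  mkℚᵘ (+ suc n) 0                   ≈⟨ *≡* (identity (+ n)) ⟩
  toℚᵘ 1ℚ ℚᵘ.+ mkℚᵘ (+ n) 0          ≈⟨ ℚᵘ.+-congʳ (toℚᵘ 1ℚ) (ℚ.toℚᵘ-fromℚᵘ (mkℚᵘ (+ n) 0)) ⟨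
  toℚᵘ 1ℚ ℚᵘ.+ toℚᵘ (+ n ℚ./ 1)      ≈⟨ ℚ.toℚᵘ-homo-+ 1ℚ (+ n ℚ./ 1) ⟨
  toℚᵘ (1ℚ ℚ.+ + n ℚ./ 1)            ∎)
  where
  open SetoidReasoning ℚᵘ.≃-setoid
  identity : ∀ i → (+ 1 ℤ.+ i) ℤ.* + 1 ≡ (+ 1 ℤ.* + 1 ℤ.+ i ℤ.* + 1) ℤ.* + 1
  identity = solve-∀

*-denominator : ∀ n d-1 .(c : Coprime n (suc d-1)) → mkℚ (+ n) d-1 c ℚ.* (+ suc d-1 ℚ./ 1) ≡ + n ℚ./ 1
*-denominator n d-1 c = ℚ.toℚᵘ-injective (begin
  toℚᵘ (mkℚ (+ n) d-1 c ℚ.* (+ suc d-1 ℚ./ 1))         ≈⟨ ℚ.toℚᵘ-homo-* (mkℚ (+ n) d-1 c) (+ suc d-1 ℚ./ 1) ⟩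
  mkℚᵘ (+ n) d-1 ℚᵘ.* toℚᵘ (+ suc d-1 ℚ./ 1)           ≈⟨ ℚᵘ.*-congˡ {mkℚᵘ (+ n) d-1} (ℚ.toℚᵘ-fromℚᵘ (mkℚᵘ (+ suc d-1) 0)) ⟩
  mkℚᵘ (+ n) d-1 ℚᵘ.* mkℚᵘ (+ suc d-1) 0               ≈⟨ *≡* (≡.trans (identity (+ n) (+ suc d-1)) (≡.cong (λ k → + n ℤ.* + k) (≡.sym (ℕ.*-identityʳ (suc d-1))))) ⟩
  mkℚᵘ (+ n) 0                                         ≈⟨ ℚ.toℚᵘ-fromℚᵘ (mkℚᵘ (+ n) 0) ⟨
  toℚᵘ (+ n ℚ./ 1)                                     ∎)
  where
  open SetoidReasoning ℚᵘ.≃-setoid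
  identity : ∀ i j → (i ℤ.* j) ℤ.* + 1 ≡ i ℤ.* j
  identity = solve-∀

module SumHomomorphism {a ℓ₁ b ℓ₂} (R : CommutativeRing a ℓ₁) (S : CommutativeRing b ℓ₂)
  {f : CommutativeRing.Carrier R → CommutativeRing.Carrier S}
  (hom : RingMorphisms.IsRingHomomorphism (CommutativeRing.rawRing R) (CommutativeRing.rawRing S) f) where
  private
    module R = CommutativeRing R
    module S = CommutativeRing S
  open RingMorphisms.IsRingHomomorphism hom
  open SemiringSum R.semiring using () renaming (sum to sumᴿ)
  open SemiringSum S.semiring using () renaming (sum to sumˢ)

  sum-*-homo : ∀ {n} (s t : Vector R.Carrier n) → f (sumᴿ (λ i → s i R.* t i)) S.≈ sumˢ (λ i → f (s i) S.* f (t i))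
  sum-*-homo {zero}  s t = 0#-homo
  sum-*-homo {suc n} s t = S.trans (+-homo _ _) (S.+-cong (*-homo _ _) (sum-*-homo (tail s) (tail t)))

module ResidueField {c ℓ₁ ℓ₂ p k κ₁ κ₂} {F : NumberField c ℓ₁ ℓ₂} {𝔭 : DyadicPrime F p}
  (F𝔭 : Completion F 𝔭 k κ₁ κ₂) where
  private
    module F where
      open NumberField F public
      open SemiringSum semiring public using (sum-cong-≋)
      open RingMorphisms.IsRingHomomorphism fromℚ-isRingHomomorphism public
    module 𝔭 = DyadicPrime 𝔭
  open Completion F𝔭 hiding (zero)
  open Valued heytingField v isDiscreteValuation
  open RingProperties ring
  open SemiringSum semiring using (sum-cong-≋; *-distribˡ-sum)
  open RingMorphisms.IsRingHomomorphism ι-isFieldEmbedding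
    renaming (⟦⟧-cong to ι-cong; +-homo to ι-+; *-homo to ι-*; -‿homo to ι-neg; 0#-homo to ι-0; 1#-homo to ι-1)

  -- The monic polynomial is X - 1.
  1-integral : F.Integral F.1#
  1-integral = 1 , (λ _ → ℤ.-1ℤ) , (begin
    F.1# F.* F.1# F.+ (F.fromℚ (ℚ.- 1ℚ) F.* F.1# F.+ F.0#)
      ≈⟨ F.+-cong (F.*-identityˡ F.1#) (F.trans (F.+-identityʳ _) (F.*-identityʳ _)) ⟩
    F.1# F.+ F.fromℚ (ℚ.- 1ℚ)
      ≈⟨ F.+-congˡ (F.trans (F.-‿homo 1ℚ) (F.-‿cong F.1#-homo)) ⟩
    F.1# F.- F.1# ≈⟨ F.-‿inverseʳ F.1# ⟩
    F.0# ∎)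
    where open SetoidReasoning F.setoid

  2∈𝔪 : 𝔪 2#
  2∈𝔪 = ∈-resp (trans (ι-+ F.1# F.1#) (+-cong ι-1 ι-1))
    (Equivalence.from (v-𝔭-adic (𝔭.integral 𝔭.2∈𝔭) 1)
      -- A sum with the single term 2 · 1 exhibits 2 as an element of 𝔭¹.
      (𝔭.product {k = 1} (λ _ → F.1# F.+ F.1#) (λ _ → F.1#) (λ _ → 𝔭.2∈𝔭) (λ _ → 𝔭.unit 1-integral)
        (F.sym (F.trans (F.+-identityʳ _) (F.*-identityʳ _)))))

  φ : ℚ → Carrier
  φ q = ι (F.fromℚ q)

  φ-* : ∀ q r → φ (q ℚ.* r) ≈ φ q * φ r
  φ-* q r = trans (ι-cong (F.*-homo q r)) (ι-* _ _)

  φ-+ : ∀ q r → φ (q ℚ.+ r) ≈ φ q + φ r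
  φ-+ q r = trans (ι-cong (F.+-homo q r)) (ι-+ _ _)

  φ-1 : φ 1ℚ ≈ 1#
  φ-1 = trans (ι-cong F.1#-homo) ι-1

  φ-0 : φ 0ℚ ≈ 0#
  φ-0 = trans (ι-cong F.0#-homo) ι-0

  φ-neg : ∀ q → φ (ℚ.- q) ≈ - φ q
  φ-neg q = trans (ι-cong (F.-‿homo q)) (ι-neg _)

  invertible≉0 : ∀ {x y} → x * y ≈ 1# → ¬ (x ≈ 0#)
  invertible≉0 xy≈1 x≈0 = 1≉0 (trans (sym xy≈1) (trans (*-congʳ x≈0) (zeroˡ _)))

  φ≉0 : ∀ {q} → q ≢ 0ℚ → ¬ (φ q ≈ 0#)
  φ≉0 {q} q≢0 = invertible≉0 (trans (sym (φ-* q (ℚ.1/ q))) (trans (reflexive (≡.cong φ (ℚ.*-inverseʳ q))) φ-1))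
    where instance _ = ℚ.≢-nonZero q≢0

  2≉0 : ¬ (2# ≈ 0#)
  2≉0 2≈0 = φ≉0 {1ℚ ℚ.+ 1ℚ} (λ ()) (trans (φ-+ 1ℚ 1ℚ) (trans (+-cong φ-1 φ-1) 2≈0))

  -- The residue lies in the prime field 𝔽₂ of the residue field.
  Bit : Carrier → Set
  Bit x = 𝔪 x ⊎ 𝔪 (x - 1#)

  bit-resp : ∀ {x y} → x ≈ y → Bit x → Bit y
  bit-resp x≈y (inj₁ x∈)   = inj₁ (∈-resp x≈y x∈)
  bit-resp x≈y (inj₂ x-1∈) = inj₂ (∈-resp (+-congʳ x≈y) x-1∈)

  bit⇒𝒪 : ∀ {x} → Bit x → 𝒪 x
  bit⇒𝒪 (inj₁ x∈)       = 𝔪⇒𝒪 x∈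
  bit⇒𝒪 {x} (inj₂ x-1∈) = ∈-resp (solve 1 (λ x → x :- con (+ 1) :+ con (+ 1) := x) refl x) (+-∈ (𝔪⇒𝒪 x-1∈) 1∈𝒪)

  -- Divisibility is kept beside the residue because coprimality of numerator and denominator speaks
  -- of divisors, not of residues.
  parity : ∀ n → (2 ∣ n × 𝔪 (φ (+ n ℚ./ 1))) ⊎ (2 ∣ suc n × 𝔪 (φ (+ n ℚ./ 1) - 1#))
  parity zero    = inj₁ (2 ∣0 , ∈-resp (sym φ-0) 0∈)
  parity (suc n) with parity n
  ... | inj₁ (2∣n , φ∈) = inj₂ (∣m∣n⇒∣m+n ∣-refl 2∣n , ∈-resp (sym (begin
          φ (+ suc n ℚ./ 1) - 1#           ≈⟨ +-congʳ (φ-suc n) ⟩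
          1# + φ (+ n ℚ./ 1) - 1#          ≈⟨ solve 1 (λ x → con (+ 1) :+ x :- con (+ 1) := x) refl _ ⟩
          φ (+ n ℚ./ 1)                    ∎)) φ∈)
    where
    open SetoidReasoning setoid
    φ-suc : ∀ n → φ (+ suc n ℚ./ 1) ≈ 1# + φ (+ n ℚ./ 1)
    φ-suc n = trans (reflexive (≡.cong φ (suc/1 n))) (trans (φ-+ 1ℚ _) (+-congʳ φ-1))
  ... | inj₂ (2∣1+n , φ-1∈) = inj₁ (2∣1+n , ∈-resp (begin
          φ (+ n ℚ./ 1) - 1# + 2#          ≈⟨ solve 1 (λ x → x :- con (+ 1) :+ con (+ 2) := con (+ 1) :+ x) refl _ ⟩
          1# + φ (+ n ℚ./ 1)               ≈⟨ +-congʳ φ-1 ⟨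
          φ 1ℚ + φ (+ n ℚ./ 1)             ≈⟨ φ-+ 1ℚ _ ⟨
          φ (1ℚ ℚ.+ + n ℚ./ 1)             ≡⟨ ≡.cong φ (suc/1 n) ⟨
          φ (+ suc n ℚ./ 1)                ∎) (+-∈ φ-1∈ 2∈𝔪))
    where open SetoidReasoning setoid

  -- Over an odd denominator the fraction is congruent to its numerator. An even denominator is
  -- impossible: coprimality excludes an even numerator, integrality an odd one.
  residue⁺ : ∀ n d-1 .(c : Coprime n (suc d-1)) → 𝒪 (φ (mkℚ (+ n) d-1 c)) → Bit (φ (mkℚ (+ n) d-1 c))
  residue⁺ n d-1 c r∈ = go (parity n) (parity (suc d-1))
    where
    r = φ (mkℚ (+ n) d-1 c)
    D = φ (+ suc d-1 ℚ./ 1)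
    N = φ (+ n ℚ./ 1)
    rD≈N : r * D ≈ N
    rD≈N = trans (sym (φ-* _ _)) (reflexive (≡.cong φ (*-denominator n d-1 c)))
    r≡N : 𝔪 (D - 1#) → 𝔪 (N - r)
    r≡N D-1∈ = ∈-resp (trans (solve 2 (λ r D → r :* (D :- con (+ 1)) := r :* D :- r) refl r D) (+-congʳ rD≈N)) (*-∈ 0 1 r∈ D-1∈)
    go : (2 ∣ n × 𝔪 N) ⊎ (2 ∣ suc n × 𝔪 (N - 1#)) → (2 ∣ suc d-1 × 𝔪 D) ⊎ (2 ∣ suc (suc d-1) × 𝔪 (D - 1#)) → Bit r
    go (inj₁ (_ , N∈)) (inj₂ (_ , D-1∈)) =
      inj₁ (∈-resp (solve 2 (λ N r → N :- (N :- r) := r) refl N r) (-∈ N∈ (r≡N D-1∈)))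
    go (inj₂ (_ , N-1∈)) (inj₂ (_ , D-1∈)) =
      inj₂ (∈-resp (solve 2 (λ N r → N :- con (+ 1) :- (N :- r) := r :- con (+ 1)) refl N r) (-∈ N-1∈ (r≡N D-1∈)))
    go (inj₁ (2∣n , _)) (inj₁ (2∣d , _)) with Coprimality.recompute c (2∣n , 2∣d)
    ... | ()
    go (inj₂ (_ , N-1∈)) (inj₁ (_ , D∈)) = contradiction
      (∈-resp (trans (+-congʳ rD≈N) (solve 1 (λ N → N :- (N :- con (+ 1)) := con (+ 1)) refl N)) (-∈ (*-∈ 0 1 r∈ D∈) N-1∈))
      (unit∉𝔪 1-unit)

  residue : ∀ q → 𝒪 (φ q) → Bit (φ q)
  residue (mkℚ (+ n) d-1 c) r∈ = residue⁺ n d-1 c r∈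
  residue (mkℚ -[1+ n ] d-1 c) r∈ with residue⁺ (suc n) d-1 c (∈-resp (sym (trans (sym (-‿involutive _)) (-‿cong (sym (φ-neg (mkℚ (+ suc n) d-1 c)))))) (-‿∈ r∈))
  ... | inj₁ r∈′   = inj₁ (∈-resp (sym (φ-neg (mkℚ (+ suc n) d-1 c))) (-‿∈ r∈′))
  -- The residue 1 is its own negative, as 1 and -1 differ by 2.
  ... | inj₂ r-1∈ = inj₂ (∈-resp
          (trans (solve 1 (λ x → :- (x :- con (+ 1)) :- con (+ 2) := :- x :- con (+ 1)) refl _) (+-congʳ (sym (φ-neg (mkℚ (+ suc n) d-1 c)))))
          (-∈ (-‿∈ r-1∈) 2∈𝔪))

  -- The Artin-Schreier map: modulo 𝔪 the sign in x² - x does not matter, since 2 lies in 𝔪.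
  ℘ : Carrier → Carrier
  ℘ x = x * x + x

  ℘-∈ : ∀ {x} → 𝒪 x → 𝒪 (℘ x)
  ℘-∈ x∈ = +-∈ (*-∈ 0 0 x∈ x∈) x∈

  ℘-cong-mod : ∀ {x y} → 𝒪 x → 𝒪 y → 𝔪 (x - y) → 𝔪 (℘ x - ℘ y)
  ℘-cong-mod {x} {y} x∈ y∈ x-y∈ = ∈-resp
    (solve 2 (λ x y → (x :- y) :* (x :+ y :+ con (+ 1)) := (x :* x :+ x) :- (y :* y :+ y)) refl x y)
    (*-∈ 1 0 x-y∈ (+-∈ (+-∈ x∈ y∈) 1∈𝒪))

  sum-∈ : ∀ {n m} (t : Vector Carrier n) → (∀ i → t i ∈𝔪^ m) → sum t ∈𝔪^ m
  sum-∈ {zero}  t t∈ = 0∈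
  sum-∈ {suc n} t t∈ = +-∈ (t∈ zero) (sum-∈ (tail t) (t∈ ∘ suc))

  -- Modulo 𝔪 the map ℘ is additive and commutes with 0 and 1, i.e. it is 𝔽₂-linear.
  ℘-sum : ∀ {n} (b x : Vector Carrier n) → (∀ i → Bit (b i)) → (∀ i → 𝒪 (x i)) →
    𝔪 (℘ (sum (λ i → b i * x i)) - sum (λ i → b i * ℘ (x i)))
  ℘-sum {zero}  b x _    _  = ∈-resp (solve 0 (con (+ 0) := (con (+ 0) :* con (+ 0) :+ con (+ 0)) :- con (+ 0)) refl) 0∈
  ℘-sum {suc n} b x bits x∈ = ∈-resp
    -- The error splits into b(b - 1)x², which is in 𝔪 as b is 0 or 1 there, the inductive error,
    -- and twice a mixed product.
    (solve 4 (λ b x s t → b :* (b :- con (+ 1)) :* (x :* x) :+ ((s :* s :+ s) :- t) :+ con (+ 2) :* (b :* x :* s) :=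
       ((b :* x :+ s) :* (b :* x :+ s) :+ (b :* x :+ s)) :- (b :* (x :* x :+ x) :+ t)) refl
       (b zero) (x zero) (sum (λ i → b (suc i) * x (suc i))) (sum (λ i → b (suc i) * ℘ (x (suc i)))))
    (+-∈ (+-∈ (*-∈ 1 0 (b[b-1]∈ (bits zero)) (*-∈ 0 0 (x∈ zero) (x∈ zero))) (℘-sum (tail b) (tail x) (bits ∘ suc) (x∈ ∘ suc)))
      (*-∈ 1 0 2∈𝔪 (*-∈ 0 0 (*-∈ 0 0 (bit⇒𝒪 (bits zero)) (x∈ zero))
        (sum-∈ (λ i → b (suc i) * x (suc i)) (λ i → *-∈ 0 0 (bit⇒𝒪 (bits (suc i))) (x∈ (suc i)))))))
    where
    b[b-1]∈ : ∀ {b} → Bit b → 𝔪 (b * (b - 1#))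
    b[b-1]∈ bit@(inj₁ b∈)   = *-∈ 1 0 b∈ (-∈ (bit⇒𝒪 bit) 1∈𝒪)
    b[b-1]∈ bit@(inj₂ b-1∈) = *-∈ 0 1 (bit⇒𝒪 bit) b-1∈

  -- Independence of a chain of iterated Artin-Schreier preimages of 1

  module ℘-Chain (x : ℕ → Carrier) (x∈ : ∀ i → 𝒪 (x i)) (x₀-1∈ : 𝔪 (x 0 - 1#))
    (N : ℕ) (℘-step : ∀ {i} → i ℕ.< N → ℘ (x (suc i)) ≈ x i) where
    open SetoidReasoning setoid

    head-∈ : ∀ {b} → 𝒪 b → 𝔪 (b * x 0) → 𝔪 b
    head-∈ {b} b∈ bx∈ = ∈-resp (solve 2 (λ b x → b :* x :- b :* (x :- con (+ 1)) := b) refl b (x 0)) (-∈ bx∈ (*-∈ 0 1 b∈ x₀-1∈))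

    ℘x₀∈ : 𝔪 (℘ (x 0))
    ℘x₀∈ = ∈-resp (solve 1 (λ x → (x :- con (+ 1)) :* (x :+ con (+ 2)) :+ con (+ 2) := x :* x :+ x) refl (x 0))
      (+-∈ (*-∈ 1 0 x₀-1∈ (+-∈ (x∈ 0) (𝔪⇒𝒪 2∈𝔪))) 2∈𝔪)

    -- Applying ℘ to a relation turns it into one among fewer terms of the chain, with shifted coefficients.
    independent : ∀ {n} → n ℕ.≤ N → (b : Vector Carrier (suc n)) → (∀ i → Bit (b i)) →
      𝔪 (sum (λ i → b i * x (toℕ i))) → ∀ i → 𝔪 (b i)
    independent {zero}  _   b bits S∈ zero = head-∈ (bit⇒𝒪 (bits zero)) (∈-resp (+-identityʳ _) S∈)
    independent {suc n} n<N b bits S∈ = λ { zero → b₀∈ ; (suc i) → tail-∈ i }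
      where
      S = sum (λ i → b i * x (toℕ i))
      T = sum (λ i → b (suc i) * x (suc (toℕ i)))
      U = sum (λ i → b (suc i) * x (toℕ i))
      ℘S-∈ : 𝔪 (℘ S - (b zero * ℘ (x 0) + U))
      ℘S-∈ = ∈-resp (+-congˡ (-‿cong (+-congˡ (sum-cong-≋ {suc n} (λ i → *-congˡ {x = b (suc i)} (℘-step (ℕ.<-≤-trans (toℕ<1+n i) n<N)))))))
        (℘-sum b (x ∘ toℕ) bits (x∈ ∘ toℕ))
        where
        toℕ<1+n : ∀ {n} (i : Fin (suc n)) → toℕ i ℕ.< suc n
        toℕ<1+n = Fin.toℕ<n
      U∈ : 𝔪 U
      U∈ = ∈-resp (solve 3 (λ p q u → p :- (p :- (q :+ u)) :- q := u) refl (℘ S) (b zero * ℘ (x 0)) U)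
        (-∈ (-∈ (+-∈ (*-∈ 1 0 S∈ (sum-∈ _ (λ i → *-∈ 0 0 (bit⇒𝒪 (bits i)) (x∈ (toℕ i))))) S∈) ℘S-∈)
          (*-∈ 0 1 (bit⇒𝒪 (bits zero)) ℘x₀∈))
      tail-∈ : ∀ i → 𝔪 (b (suc i))
      tail-∈ = independent (ℕ.<⇒≤ n<N) (tail b) (bits ∘ suc) U∈
      b₀∈ : 𝔪 (b zero)
      b₀∈ = head-∈ (bit⇒𝒪 (bits zero)) (∈-resp (solve 2 (λ a t → a :+ t :- t := a) refl (b zero * x 0) T)
        (-∈ S∈ (sum-∈ (λ i → b (suc i) * x (suc (toℕ i))) (λ i → *-∈ 1 0 (tail-∈ i) (x∈ (suc (toℕ i)))))))

  -- The iterates are formed in the number field, where linear dependence over ℚ is available.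
  ℘ᶠ : ℕ → F.Carrier → F.Carrier
  ℘ᶠ zero    y = y
  ℘ᶠ (suc n) y = ℘ᶠ n y F.* ℘ᶠ n y F.+ ℘ᶠ n y

  ι-℘ᶠ : ∀ n y → ι (℘ᶠ (suc n) y) ≈ ℘ (ι (℘ᶠ n y))
  ι-℘ᶠ n y = trans (ι-+ _ _) (+-congʳ (ι-* _ _))

  ℘ᶠ-∈ : ∀ n {y} → 𝒪 (ι y) → 𝒪 (ι (℘ᶠ n y))
  ℘ᶠ-∈ zero    y∈ = y∈
  ℘ᶠ-∈ (suc n) y∈ = ∈-resp (sym (ι-℘ᶠ n _)) (℘-∈ (℘ᶠ-∈ n y∈))

  -- The size of the given spanning set, an upper bound for the degree over ℚ.
  degree : ℕ
  degree = proj₁ F.finite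

  rational-dependence : (a : Vector F.Carrier (suc degree)) →
    Σ[ r ∈ Vector ℚ (suc degree) ] (∃[ i ] r i ≢ 0ℚ) × sum (λ i → φ (r i) * ι (a i)) ≈ 0#
  rational-dependence a = r , proj₁ (proj₂ (dependence A)) , (begin
      sum (λ i → φ (r i) * ι (a i))
        ≈⟨ ι-Sum.sum-*-homo (F.fromℚ ∘ r) a ⟨
      ι (F.sum (λ i → F.fromℚ (r i) F.* a i))
        ≈⟨ ι-cong (F.sum-cong-≋ (λ i → F.*-congˡ {x = F.fromℚ (r i)} (proj₂ (spanning (a i))))) ⟩
      ι (F.sum (λ i → F.fromℚ (r i) F.* F.sum (λ j → F.fromℚ (A i j) F.* e j)))
        ≈⟨ ι-cong (SumExchange.relation-transport F.commutativeRing (F.fromℚ ∘ r) (λ i j → F.fromℚ (A i j)) e relation) ⟩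
      ι F.0# ≈⟨ ι-0 ⟩
      0# ∎)
    where
    open SetoidReasoning setoid
    module ι-Sum = SumHomomorphism F.commutativeRing commutativeRing ι-isFieldEmbedding
    module ℚ-Sum = SumHomomorphism ℚ.+-*-commutativeRing F.commutativeRing F.fromℚ-isRingHomomorphism
    ℚ-cancel : ∀ {q r} → q ≢ 0ℚ → q ℚ.* r ≡ 0ℚ → r ≡ 0ℚ
    ℚ-cancel {q} {r} q≢0 qr≡0 = ≡.trans (≡.sym (ℚ.*-identityˡ r)) (≡.trans (≡.cong (ℚ._* r) (≡.sym (ℚ.*-inverseˡ q)))
      (≡.trans (ℚ.*-assoc (ℚ.1/ q) q r) (≡.trans (≡.cong (ℚ.1/ q ℚ.*_) qr≡0) (ℚ.*-zeroʳ (ℚ.1/ q)))))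
      where instance _ = ℚ.≢-nonZero q≢0
    open LinearDependence ℚ.+-*-commutativeRing (λ q → q ℚ.≟ 0ℚ) (λ ()) ℚ-cancel
    e = proj₁ (proj₂ F.finite)
    spanning = proj₂ (proj₂ F.finite)
    A : Fin (suc degree) → Vector ℚ degree
    A i = proj₁ (spanning (a i))
    r = proj₁ (dependence A)
    relation : ∀ j → F.sum (λ i → F.fromℚ (r i) F.* F.fromℚ (A i j)) F.≈ F.0#
    relation j = F.trans (F.sym (ℚ-Sum.sum-*-homo r (λ i → A i j)))
      (F.trans (F.⟦⟧-cong (proj₂ (proj₂ (dependence A)) j)) F.0#-homo)

  -- A rational relation is divided by its coefficient of least value. The new coefficients are
  -- integral rationals, one of them 1, so their residues lie in 𝔽₂.
  bit-dependence : (a : Vector F.Carrier (suc degree)) →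
    Σ[ b ∈ Vector Carrier (suc degree) ] (∀ i → Bit (b i)) × (∃[ j ] b j ≈ 1#) × sum (λ i → b i * ι (a i)) ≈ 0#
  bit-dependence a =
    let r , (i , ri≢0) , relation = rational-dependence a
        j , φj≉0 , quotient = scale (φ ∘ r) (i , φ≉0 ri≢0)
    in normalise r relation j φj≉0 quotient
    where
    open SetoidReasoning setoid
    normalise : ∀ r → sum (λ i → φ (r i) * ι (a i)) ≈ 0# → ∀ j → ¬ (φ (r j) ≈ 0#) →
      (∀ i → ∃[ q ] 𝒪 q × φ (r i) ≈ q * φ (r j)) →
      Σ[ b ∈ Vector Carrier (suc degree) ] (∀ i → Bit (b i)) × (∃[ j ] b j ≈ 1#) × sum (λ i → b i * ι (a i)) ≈ 0#
    normalise r relation j φj≉0 quotient = b , bits , (j , ≈1 φj≉0 (sym (φ≈bφ j))) , *-cancelˡ-0 φj≉0 (begin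
      φ (r j) * sum (λ i → b i * ι (a i))
        ≈⟨ *-distribˡ-sum (φ (r j)) (λ i → b i * ι (a i)) ⟩
      sum (λ i → φ (r j) * (b i * ι (a i)))
        ≈⟨ sum-cong-≋ (λ i → trans (solve 3 (λ p b a → p :* (b :* a) := b :* p :* a) refl (φ (r j)) (b i) (ι (a i)))
             (*-congʳ (sym (φ≈bφ i)))) ⟩
      sum (λ i → φ (r i) * ι (a i))
        ≈⟨ relation ⟩
      0# ∎)
      where
      b : Vector Carrier (suc degree)
      b i = proj₁ (quotient i)
      φ≈bφ : ∀ i → φ (r i) ≈ b i * φ (r j)
      φ≈bφ i = proj₂ (proj₂ (quotient i))
      rj≢0 : r j ≢ 0ℚ
      rj≢0 rj≡0 = φj≉0 (trans (reflexive (≡.cong φ rj≡0)) φ-0)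
      instance _ = ℚ.≢-nonZero rj≢0
      -- The quotients come from division in the local field; identifying them with images of
      -- rationals makes `residue` applicable.
      φ[r/r]≈b : ∀ i → φ (r i ℚ.* ℚ.1/ r j) ≈ b i
      φ[r/r]≈b i = begin
        φ (r i ℚ.* ℚ.1/ r j)              ≈⟨ φ-* (r i) (ℚ.1/ r j) ⟩
        φ (r i) * φ (ℚ.1/ r j)            ≈⟨ *-congʳ (φ≈bφ i) ⟩
        b i * φ (r j) * φ (ℚ.1/ r j)      ≈⟨ *-assoc _ _ _ ⟩
        b i * (φ (r j) * φ (ℚ.1/ r j))    ≈⟨ *-congˡ (φ-* (r j) (ℚ.1/ r j)) ⟨
        b i * φ (r j ℚ.* ℚ.1/ r j)        ≡⟨ ≡.cong (λ q → b i * φ q) (ℚ.*-inverseʳ (r j)) ⟩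
        b i * φ 1ℚ                        ≈⟨ trans (*-congˡ φ-1) (*-identityʳ (b i)) ⟩
        b i                               ∎
      bits : ∀ i → Bit (b i)
      bits i = bit-resp (φ[r/r]≈b i) (residue _ (∈-resp (sym (φ[r/r]≈b i)) (proj₁ (proj₂ (quotient i)))))

  -- Non-surjectivity of the Artin-Schreier map on the residue field

  module _ (surjective : ∀ ρ → 𝒪 ρ → ¬ Irreducible ρ) where

    -- Surjectivity, in doubly negated form, gives a preimage in 𝒪. By density an element of F
    -- replaces it, with precision 𝔪 because ℘ respects congruence modulo 𝔪.
    preimage : ∀ x → 𝒪 x → ¬ ¬ (∃[ a ] 𝒪 (ι a) × 𝔪 (℘ (ι a) - x))
    preimage x x∈ none = surjective (- x) (-‿∈ x∈) λ {y} y∈ ℘y-x∈ →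
      let a , y-a∈ = dense y 1
          a∈ = ∈-resp (solve 2 (λ y a → y :- (y :- a) := a) refl y (ι a)) (-∈ y∈ (𝔪⇒𝒪 y-a∈))
      in none (a , a∈ , ∈-resp
           (solve 3 (λ p q x → p :- x :- (p :- q) := q :- x) refl (℘ y) (℘ (ι a)) x)
           (-∈ ℘y-x∈ (℘-cong-mod y∈ a∈ y-a∈)))

    iterated-preimage : ∀ n x → 𝒪 (ι x) → ¬ ¬ (∃[ y ] 𝒪 (ι y) × 𝔪 (ι (℘ᶠ n y) - ι x))
    iterated-preimage zero    x x∈ none = none (x , x∈ , ∈-resp (sym (-‿inverseʳ (ι x))) 0∈)
    iterated-preimage (suc n) x x∈ none = preimage (ι x) x∈ λ { (a , a∈ , ℘a-x∈) →
      iterated-preimage n a a∈ λ { (y , y∈ , ℘ⁿy-a∈) → none (y , y∈ , ∈-resp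
        (trans (solve 3 (λ p q x → p :- q :+ (q :- x) := p :- x) refl (℘ (ι (℘ᶠ n y))) (℘ (ι a)) (ι x))
          (+-congʳ (sym (ι-℘ᶠ n y))))
        (+-∈ (℘-cong-mod (℘ᶠ-∈ n y∈) a∈ ℘ⁿy-a∈) ℘a-x∈)) } }

    ¬surjective : ⊥
    ¬surjective = iterated-preimage degree F.1# (∈-resp (sym ι-1) 1∈𝒪) λ (y , y∈ , ℘ᴺy-1∈) →
      -- The exponent `degree ∸ i` reverses the chain: index 0 carries the element congruent to 1
      -- and ℘ lowers the index. The indices 0 to `degree` give one element more than the spanning
      -- set has.
      let b , bits , (j , bj≈1) , relation = bit-dependence (λ i → ℘ᶠ (degree ℕ.∸ toℕ i) y)
          bj∈ = ℘-Chain.independent (λ i → ι (℘ᶠ (degree ℕ.∸ i) y)) (λ i → ℘ᶠ-∈ (degree ℕ.∸ i) y∈)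
            (∈-resp (+-congˡ (-‿cong ι-1)) ℘ᴺy-1∈) degree
            (λ {i} i<N → trans (sym (ι-℘ᶠ (degree ℕ.∸ suc i) y))
              (reflexive (≡.cong (λ m → ι (℘ᶠ m y)) (≡.sym (ℕ.+-∸-assoc 1 i<N)))))
            ℕ.≤-refl b bits (∈-resp (sym relation) 0∈) j
      in contradiction (∈-resp bj≈1 bj∈) (unit∉𝔪 1-unit)

  ¬¬-irreducible : ¬ ¬ (Σ[ ρ ∈ Carrier ] 𝒪 ρ × Irreducible ρ)
  ¬¬-irreducible none = ¬surjective λ ρ ρ∈ irreducible → none (ρ , ρ∈ , irreducible)

proposition4p6 : ∀ {c ℓ₁ ℓ₂ p k κ₁ κ₂} (F : NumberField c ℓ₁ ℓ₂) (𝔭 : DyadicPrime F p)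
    (F𝔭 : Completion F 𝔭 k κ₁ κ₂) →
    ¬ (∃[ M ] Lattice.rank {F𝔭 = F𝔭} M ≡ 4 × ClassicUniversal F𝔭 2 M)
proposition4p6 F 𝔭 F𝔭 (M , rank≡4 , universal) = ¬¬-irreducible λ (ρ , ρ∈𝒪 , irreducible) →
  Geometry.Contradiction.absurd F𝔭 2∈𝔪 2≉0 ρ ρ∈𝒪 irreducible M rank≡4 universal
  where open ResidueField F𝔭
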